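{- There exists no elliptic curve $E$ over $\mathbb{Q}$ that has a $\mathbb{Q}$-rational point of order $10$ and whose conductor is $N_E=p^{\alpha}q^{\beta}$, where $p\neq q$ are primes and $\alpha,\beta>0$ are integers.
   Context: For an elliptic curve $E/\mathbb{Q}$, $N_E$ denotes its conductor. -}

module Defs where

open import Algebra.Bundles.Raw using (RawRing)
open import Data.Integer.Base as ℤ using (ℤ; +_)
open import Data.Integer.Divisibility using (_∣_)
open import Data.Nat.Base as ℕ using (ℕ; zero; suc; _<_)
open import Data.Nat.Primality using (Prime)
open import Data.Product using (_×_; ∃-syntax)
open import Data.Rational.Base as ℚ
  using (ℚ; 0ℚ; 1ℚ; _+_; _-_; _*_; -_; _÷_; ≢-nonZero)
open import Data.Rational.Properties using (_≟_)
open import Data.Unit.Base using (⊤)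
open import Level using (0ℓ)
open import Relation.Binary.PropositionalEquality using (_≡_; _≢_)
open import Relation.Nullary using (¬_; yes; no)

-- y² + a₁xy + a₃y = x³ + a₂x² + a₄x + a₆

record Weierstrass (A : Set) : Set where
  constructor weierstrass
  field
    a₁ a₂ a₃ a₄ a₆ : A

module Invariants (R : RawRing 0ℓ 0ℓ) (W : Weierstrass (RawRing.Carrier R)) where
  open RawRing R
    renaming (_+_ to _⊕_; _*_ to _⊛_; -_ to ⊖_)
    using (Carrier; 1#; 0#)
  open Weierstrass W

  private
    infixl 6 _⊝_
    _⊝_ : Carrier → Carrier → Carrier
    x ⊝ y = x ⊕ (⊖ y)

    fromℕ : ℕ → Carrier
    fromℕ zero    = 0#
    fromℕ (suc n) = 1# ⊕ fromℕ n

  b₂ b₄ b₆ b₈ Δ : Carrier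
  b₂ = a₁ ⊛ a₁ ⊕ fromℕ 4 ⊛ a₂
  b₄ = fromℕ 2 ⊛ a₄ ⊕ a₁ ⊛ a₃
  b₆ = a₃ ⊛ a₃ ⊕ fromℕ 4 ⊛ a₆
  b₈ = a₁ ⊛ a₁ ⊛ a₆ ⊕ fromℕ 4 ⊛ a₂ ⊛ a₆ ⊝ a₁ ⊛ a₃ ⊛ a₄ ⊕ a₂ ⊛ a₃ ⊛ a₃ ⊝ a₄ ⊛ a₄
  Δ  = ⊖ (b₂ ⊛ b₂ ⊛ b₈) ⊝ fromℕ 8 ⊛ b₄ ⊛ b₄ ⊛ b₄ ⊝ fromℕ 27 ⊛ b₆ ⊛ b₆
         ⊕ fromℕ 9 ⊛ b₂ ⊛ b₄ ⊛ b₆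

record EllipticCurve : Set where
  field
    equation    : Weierstrass ℚ
    nonsingular : Invariants.Δ ℚ.+-*-rawRing equation ≢ 0ℚ
  open Weierstrass equation public

------------------------------------------------------------------------
-- Rational points

data Point : Set where
  𝒪   : Point
  aff : (x y : ℚ) → Point

module _ (E : EllipticCurve) where
  open EllipticCurve E

  OnCurve : Point → Set
  OnCurve 𝒪         = ⊤
  OnCurve (aff x y) =
    y * y + a₁ * x * y + a₃ * y ≡ x * x * x + a₂ * x * x + a₄ * x + a₆

  -- The third point of the curve on the line of slope m through (x₁, y₁),
  -- one of whose other intersections has abscissa x₂, reflected by
  -- (x, y) ↦ (x, - y - a₁x - a₃).
  thirdReflected : (m x₁ y₁ x₂ : ℚ) → Point
  thirdReflected m x₁ y₁ x₂ = aff x₃ (- (m * (x₃ - x₁) + y₁) - a₁ * x₃ - a₃)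
    where
    x₃ : ℚ
    x₃ = m * m + a₁ * m - a₂ - x₁ - x₂

  -- The chord-tangent law, given by formulas on all pairs of coordinates and
  -- meaningful on points satisfying OnCurve. If x₁ = x₂ on the curve, then
  -- either the points are opposite, i.e. d = 0 below, or they are equal and
  -- d = 2y₁ + a₁x₁ + a₃ is the denominator of the tangent slope.
  add : Point → Point → Point
  add 𝒪 Q = Q
  add P@(aff _ _) 𝒪 = P
  add (aff x₁ y₁) (aff x₂ y₂) with x₂ - x₁ ≟ 0ℚ
  ... | no x₂-x₁≢0 =
    thirdReflected (((y₂ - y₁) ÷ (x₂ - x₁)) {{≢-nonZero x₂-x₁≢0}}) x₁ y₁ x₂
  ... | yes _ with y₁ + y₂ + a₁ * x₁ + a₃ ≟ 0ℚ
  ...   | yes _ = 𝒪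
  ...   | no d≢0 =
    thirdReflected
      (((three * x₁ * x₁ + two * a₂ * x₁ + a₄ - a₁ * y₁)
         ÷ (y₁ + y₂ + a₁ * x₁ + a₃)) {{≢-nonZero d≢0}})
      x₁ y₁ x₂
    where
    two three : ℚ
    two   = + 2 ℚ./ 1
    three = + 3 ℚ./ 1

  multiple : ℕ → Point → Point
  multiple zero    P = 𝒪
  multiple (suc n) P = add P (multiple n P)

  HasOrder : Point → ℕ → Set
  HasOrder P n =
    0 < n × multiple n P ≡ 𝒪 × (∀ k → 0 < k → k < n → multiple k P ≢ 𝒪)

------------------------------------------------------------------------
-- Integral models

-- The substitution x = u²x′ + r, y = u³y′ + u²sx′ + t carries W to W′.
record ChangeOfVariables (W W′ : Weierstrass ℚ) : Set where
  open Weierstrass W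
  open Weierstrass W′ using ()
    renaming (a₁ to a₁′; a₂ to a₂′; a₃ to a₃′; a₄ to a₄′; a₆ to a₆′)
  field
    u r s t : ℚ
    u≢0     : u ≢ 0ℚ
    eq₁ : u * a₁′ ≡ a₁ + (s + s)
    eq₂ : u * u * a₂′ ≡ a₂ - s * a₁ + (r + r + r) - s * s
    eq₃ : u * u * u * a₃′ ≡ a₃ + r * a₁ + (t + t)
    eq₄ : u * u * u * u * a₄′
            ≡ a₄ - s * a₃ + (r + r) * a₂ - (t + r * s) * a₁
                + (r + r + r) * r - (s + s) * t
    eq₆ : u * u * u * u * u * u * a₆′
            ≡ a₆ + r * a₄ + r * r * a₂ + r * r * r - t * a₃ - t * t - r * t * a₁

toℚ : Weierstrass ℤ → Weierstrass ℚ
toℚ (weierstrass a₁ a₂ a₃ a₄ a₆) =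
  weierstrass (a₁ ℚ./ 1) (a₂ ℚ./ 1) (a₃ ℚ./ 1) (a₄ ℚ./ 1) (a₆ ℚ./ 1)

IntegralModel : EllipticCurve → Weierstrass ℤ → Set
IntegralModel E W = ChangeOfVariables (EllipticCurve.equation E) (toℚ W)

------------------------------------------------------------------------
-- Reduction types and the conductor

data Kodaira : Set where
  I I*               : ℕ → Kodaira
  II III IV IV* III* II* : Kodaira

-- Number of irreducible components, over an algebraic closure of the residue
-- field and without multiplicity, of the special fibre of the minimal regular
-- model.
components : Kodaira → ℕ
components (I zero)      = 1
components (I n@(suc _)) = n
components II            = 1
components III           = 2
components IV            = 3
components (I* n)        = 5 ℕ.+ n
components IV*           = 7
components III*          = 8
components II*           = 9

infix 4 _^_∣_ _^_∥_

_^_∣_ : ℕ → ℕ → ℤ → Set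
p ^ k ∣ x = + (p ℕ.^ k) ∣ x

_^_∥_ : ℕ → ℕ → ℤ → Set
p ^ k ∥ x = p ^ k ∣ x × ¬ p ^ suc k ∣ x

-- The equations at which Tate's algorithm at p terminates, with the type it
-- returns. The condition that a polynomial have distinct roots over an
-- algebraic closure of 𝔽_p is expressed by its discriminant: that of
-- Y² + (a₃/pⁱ) Y - a₆/p²ⁱ is b₆/p²ⁱ, that of
-- (a₂/p) X² + (a₄/pⁱ) X + a₆/p²ⁱ⁻¹ is (a₄² - 4a₂a₆)/p²ⁱ, and that of
-- T³ + (a₂/p) T² + (a₄/p²) T + a₆/p³ is cubicDisc/p⁶.
-- Any such equation is minimal at p, and every elliptic curve over ℚ has one
-- with integer coefficients, always of the same type.
module _ (p : ℕ) (W : Weierstrass ℤ) where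
  open Weierstrass W
  open Invariants ℤ.+-*-rawRing W

  quadraticDisc cubicDisc : ℤ
  quadraticDisc = a₄ ℤ.* a₄ ℤ.- + 4 ℤ.* a₂ ℤ.* a₆
  cubicDisc =
    a₂ ℤ.* a₂ ℤ.* a₄ ℤ.* a₄
      ℤ.- + 4 ℤ.* a₄ ℤ.* a₄ ℤ.* a₄
      ℤ.- + 4 ℤ.* a₂ ℤ.* a₂ ℤ.* a₂ ℤ.* a₆
      ℤ.- + 27 ℤ.* a₆ ℤ.* a₆
      ℤ.+ + 18 ℤ.* a₂ ℤ.* a₄ ℤ.* a₆

  -- pᵉⁱ ∣ aᵢ for all i
  CoefficientsDivisible : (e₁ e₂ e₃ e₄ e₆ : ℕ) → Set
  CoefficientsDivisible e₁ e₂ e₃ e₄ e₆ =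
    p ^ e₁ ∣ a₁ × p ^ e₂ ∣ a₂ × p ^ e₃ ∣ a₃ × p ^ e₄ ∣ a₄ × p ^ e₆ ∣ a₆

  data TateForm : Kodaira → Set where
    good : ¬ p ^ 1 ∣ Δ → TateForm (I 0)

    multiplicative : ∀ {n} → CoefficientsDivisible 0 0 1 1 1 →
      ¬ p ^ 1 ∣ b₂ → p ^ n ∥ Δ → TateForm (I n)

    typeII : CoefficientsDivisible 0 0 1 1 1 → p ^ 1 ∣ b₂ →
      ¬ p ^ 2 ∣ a₆ → TateForm II

    typeIII : CoefficientsDivisible 0 0 1 1 2 → p ^ 1 ∣ b₂ →
      ¬ p ^ 3 ∣ b₈ → TateForm III

    typeIV : CoefficientsDivisible 0 0 1 1 2 → p ^ 1 ∣ b₂ →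
      p ^ 3 ∣ b₈ → ¬ p ^ 3 ∣ b₆ → TateForm IV

    typeI*₀ : CoefficientsDivisible 1 1 2 2 3 →
      ¬ p ^ 7 ∣ cubicDisc → TateForm (I* 0)

    typeI*-odd : ∀ k → CoefficientsDivisible 1 1 (2 ℕ.+ k) (3 ℕ.+ k) (4 ℕ.+ 2 ℕ.* k) →
      ¬ p ^ 2 ∣ a₂ → ¬ p ^ (5 ℕ.+ 2 ℕ.* k) ∣ b₆ →
      TateForm (I* (1 ℕ.+ 2 ℕ.* k))

    typeI*-even : ∀ k → CoefficientsDivisible 1 1 (3 ℕ.+ k) (3 ℕ.+ k) (5 ℕ.+ 2 ℕ.* k) →
      ¬ p ^ 2 ∣ a₂ → ¬ p ^ (7 ℕ.+ 2 ℕ.* k) ∣ quadraticDisc →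
      TateForm (I* (2 ℕ.+ 2 ℕ.* k))

    typeIV* : CoefficientsDivisible 1 2 2 3 4 →
      ¬ p ^ 5 ∣ b₆ → TateForm IV*

    typeIII* : CoefficientsDivisible 1 2 3 3 5 →
      ¬ p ^ 4 ∣ a₄ → TateForm III*

    typeII* : CoefficientsDivisible 1 2 3 4 5 →
      ¬ p ^ 6 ∣ a₆ → TateForm II*

-- Ogg's formula f = v(Δ) + 1 - m, where Δ is the discriminant of an equation
-- minimal at p and m is the number of components. This includes the wild part
-- at 2 and 3.
ConductorExponent : EllipticCurve → ℕ → ℕ → Set
ConductorExponent E p f =
  ∃[ W ] ∃[ T ] ∃[ v ]
    IntegralModel E W × TateForm p W T ×
    p ^ v ∥ Invariants.Δ ℤ.+-*-rawRing W × components T ℕ.+ f ≡ v ℕ.+ 1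

-- N = ∏ₚ p^fₚ; N ≠ 0 is implied, as no pᵏ divides 0 exactly.
IsConductor : EllipticCurve → ℕ → Set
IsConductor E N =
  ∀ p → Prime p → ∃[ f ] ConductorExponent E p f × p ^ f ∥ + N

{-# OPTIONS --safe #-}

-- A point P of order 10 puts the curve into Kubert's one-parameter family: in
-- coordinates centred at P the multiples of P satisfy a recurrence, which read
-- backwards from 10P = 𝒪 gives 5P = -5P, i.e. one equation on the Tate normal
-- form, solved by a rational parameter e = m / n in lowest terms. Comparing Δ
-- and c₄ of an integral equation of this curve with those of an equation with
-- good reduction at ℓ shows that every prime ℓ dividing
--   m n (m - n) (2m - n) (m² - 3mn + n²)
-- is a prime of bad reduction. One of m, n, m - n is even, and the other two
-- and m² - 3mn + n² are odd and pairwise coprime. If 2 and one odd prime are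
-- the only bad primes, two of these three are ± 1, which leaves four curves;
-- each of them has bad reduction at 2, 3 and 5 or at 2, 3 and 11.

module Submission where

open import Defs
open import Data.Bool.Base using (T; _∧_)
open import Data.Bool.Properties using (T-∧)
open import Data.Integer.Base as ℤ using (ℤ; +_; -[1+_]; ∣_∣; 0ℤ)
import Data.Integer.Divisibility as U
open import Data.Integer.Divisibility.Signed
  using (divides; ∣⇒∣ᵤ; ∣ᵤ⇒∣; ∣-trans; ∣m∣n⇒∣m+n; ∣m⇒∣-m; ∣m⇒∣m*n; ∣n⇒∣m*n; _∣?_)
  renaming (_∣_ to _∣ℤ_)
import Data.Integer.DivMod as ℤ
import Data.Integer.Properties as ℤ
import Data.Integer.Tactic.RingSolver as ℤSolver
open import Data.List.Base using ([]; _∷_)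
import Data.List.Relation.Unary.All as All
open import Data.Nat.Base as ℕ using (ℕ; zero; suc; _≤_; _^_; _⊓_; _≤ᵇ_; s≤s; z<s; s<s)
open import Data.Nat.Coprimality as ℕ using (Coprime)
import Data.Nat.Divisibility as ℕ
open import Data.Nat.ListAction using (product)
open import Data.Nat.Primality
  using (Prime; prime?; prime[2]; prime⇒irreducible; ¬prime[0]; ¬prime[1]; euclidsLemma)
open import Data.Nat.Primality.Factorisation using (factorise)
import Data.Nat.Properties as ℕ
open import Data.Product using (_×_; ∃-syntax; _,_; proj₁; proj₂)
open import Data.Rational.Base as ℚ using (ℚ; mkℚ; toℚᵘ; 0ℚ; 1ℚ; ↥_; ↧_; 1/_; ≢-nonZero)
import Data.Rational.Properties as ℚ
import Data.Rational.Unnormalised.Base as ℚᵘ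
import Data.Rational.Unnormalised.Properties as ℚᵘ
open import Data.Sum.Base using (_⊎_; inj₁; inj₂; [_,_]′; swap)
open import Function.Base using (id; _∘_)
open import Function.Bundles using (Equivalence)
open import Relation.Binary.PropositionalEquality
open import Relation.Nullary using (¬_; Dec; yes; no; contradiction)
open import Relation.Nullary.Decidable using (dec⇒maybe; from-yes; from-no)
open import Tactic.RingSolver.Core.AlmostCommutativeRing
  using (AlmostCommutativeRing; fromCommutativeRing)

-- The integral equations obtained from a point of order 10 come with no proof of minimality, so a
-- prime ℓ dividing their Δ is not yet known to be bad. This is why c₄ is needed: if another
-- integral equation of the curve has good reduction at such an ℓ, then ℓ divides the numerator of
-- the ratio of the two scaling factors, and ℓ⁴, in particular ℓ², divides c₄. Thus ℓ ∣ Δ together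
-- with ℓ² ∤ c₄ certifies bad reduction.
--
-- Two primes need care. The form m² - 3mn + n² has discriminant 5, and when 5 divides it, 5 also
-- divides c₄; the test therefore has to tolerate one factor ℓ. When n is even, the equation is not
-- minimal at 2, and a second one with smaller coefficients takes its place there.
--
-- The conductor is tied to good reduction by counting: every Kodaira type other than I₀ has at most
-- v(Δ) components, so Ogg's formula gives exponent 0 only for I₀.

-- Divisibility of the discriminant at each step of Tate's algorithm

-- Exponents occurring in TateForm are linear in the parameter k; a pair
-- (c , d) encodes c + d k, so that comparing exponents is a computation.
module TateDivisibility (p k : ℕ) where

  Exponent : Set
  Exponent = ℕ × ℕ

  -- `1 * k` unfolds to `k + 0`, which is stuck. The separate clause makes `exponent (2 , 1)`
  -- definitionally `2 + k`, the form in which `TateForm` writes it.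
  multipleOf-k : ℕ → ℕ
  multipleOf-k 1 = k
  multipleOf-k d = d ℕ.* k

  multipleOf-k-correct : ∀ d → multipleOf-k d ≡ d ℕ.* k
  multipleOf-k-correct 0             = refl
  multipleOf-k-correct 1             = sym (ℕ.+-identityʳ k)
  multipleOf-k-correct (suc (suc d)) = refl

  exponent : Exponent → ℕ
  exponent (c , d) = c ℕ.+ multipleOf-k d

  exponent-mono : ∀ {c c′ d d′} → c ≤ c′ → d ≤ d′ →
                  exponent (c , d) ≤ exponent (c′ , d′)
  exponent-mono {d = d} {d′} c≤c′ d≤d′
    rewrite multipleOf-k-correct d | multipleOf-k-correct d′ =
    ℕ.+-mono-≤ c≤c′ (ℕ.*-monoˡ-≤ k d≤d′)

  exponent-+ : ∀ c d c′ d′ →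
    exponent (c ℕ.+ c′ , d ℕ.+ d′) ≡ exponent (c , d) ℕ.+ exponent (c′ , d′)
  exponent-+ c d c′ d′
    rewrite multipleOf-k-correct d | multipleOf-k-correct d′
          | multipleOf-k-correct (d ℕ.+ d′) | ℕ.*-distribʳ-+ k d d′ =
    +-interchange c c′ (d ℕ.* k) (d′ ℕ.* k)
    where open import Algebra.Properties.CommutativeSemigroup ℕ.+-commutativeSemigroup
            using () renaming (interchange to +-interchange)

  DivisibleBy : Exponent → ℤ → Set
  DivisibleBy e x = + (p ^ exponent e) ∣ℤ x

  -- The exponent is data: the operations below compute a lower bound for the valuation along with
  -- the expression, and `weaken` compares it with the desired bound by evaluation.
  Divisible : ℤ → Set
  Divisible x = ∃[ e ] DivisibleBy e x

  ^-mono-∣ : ∀ {i j} → i ≤ j → + (p ^ i) ∣ℤ + (p ^ j)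
  ^-mono-∣ {i} {j} i≤j = ∣ᵤ⇒∣ (ℕ.divides (p ^ (j ℕ.∸ i)) (begin
    p ^ j                     ≡⟨ cong (p ^_) (ℕ.m∸n+n≡m i≤j) ⟨
    p ^ (j ℕ.∸ i ℕ.+ i)       ≡⟨ ℕ.^-distribˡ-+-* p (j ℕ.∸ i) i ⟩
    p ^ (j ℕ.∸ i) ℕ.* p ^ i   ∎))
    where open ≡-Reasoning

  infixl 6 _⊕_ _⊝_
  infixl 7 _⊗_

  _⊕_ : ∀ {x y} → Divisible x → Divisible y → Divisible (x ℤ.+ y)
  ((c , d) , e∣x) ⊕ ((c′ , d′) , e′∣y) = (c ⊓ c′ , d ⊓ d′) ,
    ∣m∣n⇒∣m+n
      (∣-trans (^-mono-∣ (exponent-mono (ℕ.m⊓n≤m c c′) (ℕ.m⊓n≤m d d′))) e∣x)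
      (∣-trans (^-mono-∣ (exponent-mono (ℕ.m⊓n≤n c c′) (ℕ.m⊓n≤n d d′))) e′∣y)

  neg : ∀ {x} → Divisible x → Divisible (ℤ.- x)
  neg (e , e∣x) = e , ∣m⇒∣-m e∣x

  _⊝_ : ∀ {x y} → Divisible x → Divisible y → Divisible (x ℤ.- y)
  e∣x ⊝ e′∣y = e∣x ⊕ neg e′∣y

  product-∣ : ∀ e e′ {x y} → DivisibleBy e x → DivisibleBy e′ y →
    DivisibleBy (proj₁ e ℕ.+ proj₁ e′ , proj₂ e ℕ.+ proj₂ e′) (x ℤ.* y)
  product-∣ e@(c , d) e′@(c′ , d′) (divides x′ refl) (divides y′ refl) =
    divides (x′ ℤ.* y′) (begin
      x′ ℤ.* + i ℤ.* (y′ ℤ.* + j)       ≡⟨ interchange x′ (+ i) y′ (+ j) ⟩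
      x′ ℤ.* y′ ℤ.* (+ i ℤ.* + j)       ≡⟨ cong (x′ ℤ.* y′ ℤ.*_) (ℤ.pos-* i j) ⟨
      x′ ℤ.* y′ ℤ.* + (i ℕ.* j)         ≡⟨ cong (λ k → x′ ℤ.* y′ ℤ.* + k) power ⟨
      x′ ℤ.* y′ ℤ.* + (p ^ exponent (c ℕ.+ c′ , d ℕ.+ d′)) ∎)
    where
    open ≡-Reasoning
    open import Algebra.Properties.CommutativeSemigroup ℤ.*-commutativeSemigroup
    i j : ℕ
    i = p ^ exponent e
    j = p ^ exponent e′
    power : p ^ exponent (c ℕ.+ c′ , d ℕ.+ d′) ≡ i ℕ.* j
    power = trans (cong (p ^_) (exponent-+ c d c′ d′))
                  (ℕ.^-distribˡ-+-* p (exponent e) (exponent e′))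

  _⊗_ : ∀ {x y} → Divisible x → Divisible y → Divisible (x ℤ.* y)
  (e@(c , d) , e∣x) ⊗ (e′@(c′ , d′) , e′∣y) =
    (c ℕ.+ c′ , d ℕ.+ d′) , product-∣ e e′ e∣x e′∣y

  constant : ∀ x → Divisible x
  constant x = (0 , 0) , divides x (sym (ℤ.*-identityʳ x))

  divisible : ∀ e {x} → p ^ exponent e ∣ x → Divisible x
  divisible e e∣x = e , ∣ᵤ⇒∣ e∣x

  weaken : ∀ c d x (D : Divisible x) →
           {T ((c ≤ᵇ proj₁ (proj₁ D)) ∧ (d ≤ᵇ proj₂ (proj₁ D)))} →
           p ^ exponent (c , d) ∣ x
  weaken c d x (_ , e∣x) {le} = ∣⇒∣ᵤ
    (∣-trans (^-mono-∣ (exponent-mono (ℕ.≤ᵇ⇒≤ c _ (proj₁ c,d)) (ℕ.≤ᵇ⇒≤ d _ (proj₂ c,d)))) e∣x)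
    where c,d = Equivalence.to T-∧ le

  module _ (W : Weierstrass ℤ) where
    open Weierstrass W
    open Invariants ℤ.+-*-rawRing W

    -- A bound for b₂ is passed separately because for types II, III and IV the prime divides b₂
    -- although a₁ and a₂ may be units.
    discriminant-divisible : Divisible a₁ → Divisible a₂ → Divisible a₃ →
      Divisible a₄ → Divisible a₆ → Divisible b₂ → Divisible Δ
    discriminant-divisible D₁ D₂ D₃ D₄ D₆ B₂ =
      neg (B₂ ⊗ B₂ ⊗ B₈) ⊝ constant (+ 8) ⊗ B₄ ⊗ B₄ ⊗ B₄ ⊝ constant (+ 27) ⊗ B₆ ⊗ B₆
        ⊕ constant (+ 9) ⊗ B₂ ⊗ B₄ ⊗ B₆
      where
      B₄ : Divisible b₄
      B₄ = constant (+ 2) ⊗ D₄ ⊕ D₁ ⊗ D₃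
      B₆ : Divisible b₆
      B₆ = D₃ ⊗ D₃ ⊕ constant (+ 4) ⊗ D₆
      B₈ : Divisible b₈
      B₈ = D₁ ⊗ D₁ ⊗ D₆ ⊕ constant (+ 4) ⊗ D₂ ⊗ D₆ ⊝ D₁ ⊗ D₃ ⊗ D₄ ⊕ D₂ ⊗ D₃ ⊗ D₃ ⊝ D₄ ⊗ D₄

    b₂-divisible : Divisible a₁ → Divisible a₂ → Divisible b₂
    b₂-divisible D₁ D₂ = D₁ ⊗ D₁ ⊕ constant (+ 4) ⊗ D₂

module _ {p : ℕ} {W : Weierstrass ℤ} where
  open Weierstrass W
  open Invariants ℤ.+-*-rawRing W using (b₂; Δ)
  open TateDivisibility p using (Exponent; exponent; Divisible)

  discriminant-divisible-b₂ : ∀ k (e₁ e₂ e₃ e₄ e₆ : Exponent k) →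
    CoefficientsDivisible p W (exponent k e₁) (exponent k e₂) (exponent k e₃)
      (exponent k e₄) (exponent k e₆) →
    p ^ 1 ∣ b₂ → Divisible k Δ
  discriminant-divisible-b₂ k e₁ e₂ e₃ e₄ e₆ (d₁ , d₂ , d₃ , d₄ , d₆) p∣b₂ =
    discriminant-divisible W (divisible e₁ d₁) (divisible e₂ d₂) (divisible e₃ d₃)
      (divisible e₄ d₄) (divisible e₆ d₆) (divisible (1 , 0) p∣b₂)
    where open TateDivisibility p k

  discriminant-divisible-a : ∀ k (e₁ e₂ e₃ e₄ e₆ : Exponent k) →
    CoefficientsDivisible p W (exponent k e₁) (exponent k e₂) (exponent k e₃)
      (exponent k e₄) (exponent k e₆) →
    Divisible k Δ
  discriminant-divisible-a k e₁ e₂ e₃ e₄ e₆ (d₁ , d₂ , d₃ , d₄ , d₆) =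
    discriminant-divisible W D₁ D₂ (divisible e₃ d₃) (divisible e₄ d₄) (divisible e₆ d₆)
      (b₂-divisible W D₁ D₂)
    where
    open TateDivisibility p k
    D₁ = divisible e₁ d₁
    D₂ = divisible e₂ d₂

  -- This makes f = v(Δ) + 1 - m positive. For I n with n > 0 there are exactly v(Δ) components; for
  -- the additive types a term-by-term estimate of Δ suffices.
  components-discriminant : ∀ {T} → TateForm p W T → T ≢ I 0 → p ^ components T ∣ Δ
  components-discriminant (good _) T≢I₀ = contradiction refl T≢I₀
  components-discriminant (multiplicative {zero} _ _ _) T≢I₀ = contradiction refl T≢I₀
  components-discriminant (multiplicative {suc n} _ _ (pⁿ∣Δ , _)) _ = pⁿ∣Δ
  components-discriminant (typeII ds p∣b₂ _) _ = weaken 1 0 Δ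
    (discriminant-divisible-b₂ 0 (0 , 0) (0 , 0) (1 , 0) (1 , 0) (1 , 0) ds p∣b₂)
    where open TateDivisibility p 0
  components-discriminant (typeIII ds p∣b₂ _) _ = weaken 2 0 Δ
    (discriminant-divisible-b₂ 0 (0 , 0) (0 , 0) (1 , 0) (1 , 0) (2 , 0) ds p∣b₂)
    where open TateDivisibility p 0
  components-discriminant (typeIV ds p∣b₂ _ _) _ = weaken 3 0 Δ
    (discriminant-divisible-b₂ 0 (0 , 0) (0 , 0) (1 , 0) (1 , 0) (2 , 0) ds p∣b₂)
    where open TateDivisibility p 0
  components-discriminant (typeI*₀ ds _) _ = weaken 5 0 Δ
    (discriminant-divisible-a 0 (1 , 0) (1 , 0) (2 , 0) (2 , 0) (3 , 0) ds)
    where open TateDivisibility p 0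
  components-discriminant (typeI*-odd k ds _ _) _ = weaken 6 2 Δ
    (discriminant-divisible-a k (1 , 0) (1 , 0) (2 , 1) (3 , 1) (4 , 2) ds)
    where open TateDivisibility p k
  components-discriminant (typeI*-even k ds _ _) _ = weaken 7 2 Δ
    (discriminant-divisible-a k (1 , 0) (1 , 0) (3 , 1) (3 , 1) (5 , 2) ds)
    where open TateDivisibility p k
  components-discriminant (typeIV* ds _) _ = weaken 7 0 Δ
    (discriminant-divisible-a 0 (1 , 0) (2 , 0) (2 , 0) (3 , 0) (4 , 0) ds)
    where open TateDivisibility p 0
  components-discriminant (typeIII* ds _) _ = weaken 8 0 Δ
    (discriminant-divisible-a 0 (1 , 0) (2 , 0) (3 , 0) (3 , 0) (5 , 0) ds)
    where open TateDivisibility p 0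
  components-discriminant (typeII* ds _) _ = weaken 9 0 Δ
    (discriminant-divisible-a 0 (1 , 0) (2 , 0) (3 , 0) (4 , 0) (5 , 0) ds)
    where open TateDivisibility p 0

  tateForm-I₀ : TateForm p W (I 0) → ¬ p ^ 1 ∣ Δ
  tateForm-I₀ (good p∤Δ)                   = p∤Δ
  -- With n = 0 this constructor also has type `I 0`, and then `p ^ 0 ∥ Δ` contains the claim.
  tateForm-I₀ (multiplicative _ _ (_ , p∤Δ)) = p∤Δ

I₀? : ∀ T → Dec (T ≡ I 0)
I₀? (I zero)    = yes refl
I₀? (I (suc _)) = no λ ()
I₀? (I* _)      = no λ ()
I₀? II          = no λ ()
I₀? III         = no λ ()
I₀? IV          = no λ ()
I₀? IV*         = no λ ()
I₀? III*        = no λ ()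
I₀? II*         = no λ ()

GoodModel : EllipticCurve → ℕ → Set
GoodModel E p = ∃[ W ] IntegralModel E W × ¬ + p ∣ℤ Invariants.Δ ℤ.+-*-rawRing W

conductorExponent-0⇒goodModel : ∀ E p → ConductorExponent E p 0 → GoodModel E p
conductorExponent-0⇒goodModel E p (W , T , v , model , tate , (_ , p^1+v∤Δ) , ogg) with I₀? T
... | yes refl = W , model , λ p∣Δ →
  tateForm-I₀ tate (subst (λ q → + q U.∣ Δ) (sym (ℕ.^-identityʳ p)) (∣⇒∣ᵤ p∣Δ))
  where open Invariants ℤ.+-*-rawRing W using (Δ)
... | no T≢I₀ = contradiction
  (subst (λ m → p ^ m ∣ Δ) m≡1+v (components-discriminant tate T≢I₀)) p^1+v∤Δ
  where
  open Invariants ℤ.+-*-rawRing W using (Δ)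
  m≡1+v : components T ≡ suc v
  m≡1+v = trans (sym (ℕ.+-identityʳ _)) (trans ogg (ℕ.+-comm v 1))

-- Weierstrass equations over ℚ and the behaviour of Δ and c₄ under substitutions

module RationalModels where
  open import Data.Rational.Base using (_+_; _-_; _*_; -_; _÷_)
  open import Tactic.RingSolver using (solve-∀)

  ℚ-ring : AlmostCommutativeRing _ _
  ℚ-ring = fromCommutativeRing ℚ.+-*-commutativeRing (λ x → dec⇒maybe (0ℚ ℚ.≟ x))

  *-cancelˡ : ∀ z {x y} → z ≢ 0ℚ → z * x ≡ z * y → x ≡ y
  *-cancelˡ z {x} {y} z≢0 eq = begin
    x                ≡⟨ inverse x ⟨
    1/ z * (z * x)   ≡⟨ cong (1/ z *_) eq ⟩
    1/ z * (z * y)   ≡⟨ inverse y ⟩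
    y                ∎
    where
    open ≡-Reasoning
    instance
      z-nonZero : ℚ.NonZero z
      z-nonZero = ≢-nonZero z≢0
    inverse : ∀ w → 1/ z * (z * w) ≡ w
    inverse w = trans (sym (ℚ.*-assoc (1/ z) z w))
      (trans (cong (_* w) (ℚ.*-inverseˡ z)) (ℚ.*-identityˡ w))

  *-cancelʳ : ∀ z {x y} → z ≢ 0ℚ → x * z ≡ y * z → x ≡ y
  *-cancelʳ z {x} {y} z≢0 eq =
    *-cancelˡ z z≢0 (trans (ℚ.*-comm z x) (trans eq (ℚ.*-comm y z)))

  *-≢0 : ∀ {x y} → x ≢ 0ℚ → y ≢ 0ℚ → x * y ≢ 0ℚ
  *-≢0 {x} x≢0 y≢0 xy≡0 = y≢0 (*-cancelˡ x x≢0 (trans xy≡0 (sym (ℚ.*-zeroʳ x))))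

  divide : ∀ x {z} → z ≢ 0ℚ → ∃[ q ] q * z ≡ x
  divide x {z} z≢0 = x * 1/ z , (begin
    x * 1/ z * z     ≡⟨ ℚ.*-assoc x (1/ z) z ⟩
    x * (1/ z * z)   ≡⟨ cong (x *_) (ℚ.*-inverseˡ z) ⟩
    x * 1ℚ           ≡⟨ ℚ.*-identityʳ x ⟩
    x                ∎)
    where
    open ≡-Reasoning
    instance
      z-nonZero : ℚ.NonZero z
      z-nonZero = ≢-nonZero z≢0

  -- Integers as rationals

  ι : ℤ → ℚ
  ι i = i ℚ./ 1

  -- `i / 1` is normalised through a gcd and is stuck for a variable `i`; on `mkℚ i 0 _` the
  -- rational operations compute.
  ι-canonical : ∀ i → ι i ≡ mkℚ i 0 (ℕ.sym (ℕ.1-coprimeTo _))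
  ι-canonical i = ℚ.↥p/↧p≡p (mkℚ i 0 (ℕ.sym (ℕ.1-coprimeTo _)))

  ι-injective : ∀ {i j} → ι i ≡ ι j → i ≡ j
  ι-injective {i} {j} eq =
    cong ↥_ (trans (sym (ι-canonical i)) (trans eq (ι-canonical j)))

  ι-+ : ∀ i j → ι i + ι j ≡ ι (i ℤ.+ j)
  ι-+ i j rewrite ι-canonical i | ι-canonical j =
    cong ι (cong₂ ℤ._+_ (ℤ.*-identityʳ i) (ℤ.*-identityʳ j))

  ι-* : ∀ i j → ι i * ι j ≡ ι (i ℤ.* j)
  ι-* i j rewrite ι-canonical i | ι-canonical j = refl

  ι-neg : ∀ i → - ι i ≡ ι (ℤ.- i)
  ι-neg (+ zero)      = refl
  ι-neg (+ (suc n))   = refl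
  ι-neg (-[1+ n ])    = ⁻¹-involutive (ι (+ suc n))
    where open import Algebra.Properties.Group ℚ.+-0-group using (⁻¹-involutive)

  infix 4 _≈ι_
  -- A record rather than a bare equation, so that unification recovers `x` and `i`. That a
  -- polynomial commutes with `ι` is then proved by writing the polynomial with `⊞`, `⊟` and `⊠`.
  record _≈ι_ (x : ℚ) (i : ℤ) : Set where
    constructor mk
    field equal : x ≡ ι i
  open _≈ι_

  infixl 6 _⊞_ _⊟_
  infixl 7 _⊠_

  _⊞_ : ∀ {x y i j} → x ≈ι i → y ≈ι j → x + y ≈ι i ℤ.+ j
  _⊞_ {i = i} {j} (mk refl) (mk refl) = mk (ι-+ i j)

  _⊠_ : ∀ {x y i j} → x ≈ι i → y ≈ι j → x * y ≈ι i ℤ.* j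
  _⊠_ {i = i} {j} (mk refl) (mk refl) = mk (ι-* i j)

  ⊟_ : ∀ {x i} → x ≈ι i → - x ≈ι ℤ.- i
  ⊟_ {i = i} (mk refl) = mk (ι-neg i)

  _⊟_ : ∀ {x y i j} → x ≈ι i → y ≈ι j → x - y ≈ι i ℤ.- j
  x ⊟ y = x ⊞ (⊟ y)

  cast : ∀ i → ι i ≈ι i
  cast i = mk refl

  module _ (W : Weierstrass ℤ) where
    open Weierstrass W
    private
      module Z = Invariants ℤ.+-*-rawRing W
      module Q = Invariants ℚ.+-*-rawRing (toℚ W)
      A₁ = cast a₁
      A₂ = cast a₂
      A₃ = cast a₃
      A₄ = cast a₄
      A₆ = cast a₆

    ι-b₂ : Q.b₂ ≈ι Z.b₂
    ι-b₂ = A₁ ⊠ A₁ ⊞ cast (+ 4) ⊠ A₂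

    ι-b₄ : Q.b₄ ≈ι Z.b₄
    ι-b₄ = cast (+ 2) ⊠ A₄ ⊞ A₁ ⊠ A₃

    ι-b₆ : Q.b₆ ≈ι Z.b₆
    ι-b₆ = A₃ ⊠ A₃ ⊞ cast (+ 4) ⊠ A₆

    ι-b₈ : Q.b₈ ≈ι Z.b₈
    ι-b₈ = A₁ ⊠ A₁ ⊠ A₆ ⊞ cast (+ 4) ⊠ A₂ ⊠ A₆ ⊟ A₁ ⊠ A₃ ⊠ A₄ ⊞ A₂ ⊠ A₃ ⊠ A₃ ⊟ A₄ ⊠ A₄

    ι-Δ : Q.Δ ≈ι Z.Δ
    ι-Δ = (⊟ (ι-b₂ ⊠ ι-b₂ ⊠ ι-b₈)) ⊟ cast (+ 8) ⊠ ι-b₄ ⊠ ι-b₄ ⊠ ι-b₄ ⊟ cast (+ 27) ⊠ ι-b₆ ⊠ ι-b₆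
            ⊞ cast (+ 9) ⊠ ι-b₂ ⊠ ι-b₄ ⊠ ι-b₆

  -- Change of variables

  c₄ : (W : Weierstrass ℚ) → ℚ
  c₄ W = b₂ * b₂ - ι (+ 24) * b₄
    where open Invariants ℚ.+-*-rawRing W

  cube fourth twelfth : ℚ → ℚ
  cube    x = x * x * x
  fourth  x = x * x * (x * x)
  twelfth x = cube (fourth x)

  -- 4Δ with b₈ eliminated by 4b₈ = b₂b₆ - b₄², so that the transformation of Δ follows from those
  -- of b₂, b₄ and b₆.
  discriminantForm : ℚ → ℚ → ℚ → ℚ
  discriminantForm b₂ b₄ b₆ =
    - (b₂ * b₂ * (b₂ * b₆ - b₄ * b₄)) - ι (+ 32) * b₄ * b₄ * b₄ - ι (+ 108) * b₆ * b₆
      + ι (+ 36) * b₂ * b₄ * b₆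

  4Δ-identity : ∀ a₁ a₂ a₃ a₄ a₆ →
    let b₂ = a₁ * a₁ + ι (+ 4) * a₂
        b₄ = ι (+ 2) * a₄ + a₁ * a₃
        b₆ = a₃ * a₃ + ι (+ 4) * a₆
        b₈ = a₁ * a₁ * a₆ + ι (+ 4) * a₂ * a₆ - a₁ * a₃ * a₄ + a₂ * a₃ * a₃ - a₄ * a₄
    in ι (+ 4) * (- (b₂ * b₂ * b₈) - ι (+ 8) * b₄ * b₄ * b₄ - ι (+ 27) * b₆ * b₆
                   + ι (+ 9) * b₂ * b₄ * b₆)
       ≡ - (b₂ * b₂ * (b₂ * b₆ - b₄ * b₄)) - ι (+ 32) * b₄ * b₄ * b₄ - ι (+ 108) * b₆ * b₆
           + ι (+ 36) * b₂ * b₄ * b₆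
  4Δ-identity = solve-∀ ℚ-ring

  4Δ : ∀ W → let open Invariants ℚ.+-*-rawRing W in ι (+ 4) * Δ ≡ discriminantForm b₂ b₄ b₆
  4Δ (weierstrass a₁ a₂ a₃ a₄ a₆) = 4Δ-identity a₁ a₂ a₃ a₄ a₆

  module _ {W W′ : Weierstrass ℚ} (C : ChangeOfVariables W W′) where
    open ChangeOfVariables C
    open Weierstrass W
    open Weierstrass W′ using ()
      renaming (a₁ to a₁′; a₂ to a₂′; a₃ to a₃′; a₄ to a₄′; a₆ to a₆′)
    private
      module I  = Invariants ℚ.+-*-rawRing W
      module I′ = Invariants ℚ.+-*-rawRing W′

    b₂-transform : u * u * I′.b₂ ≡ I.b₂ + ι (+ 12) * r
    b₂-transform = begin
      u * u * I′.b₂                                                        ≡⟨ scale u a₁′ a₂′ ⟩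
      u * a₁′ * (u * a₁′) + ι (+ 4) * (u * u * a₂′)
        ≡⟨ cong₂ (λ x y → x * x + ι (+ 4) * y) eq₁ eq₂ ⟩
      (a₁ + (s + s)) * (a₁ + (s + s)) + ι (+ 4) * (a₂ - s * a₁ + (r + r + r) - s * s)
        ≡⟨ expand a₁ a₂ r s ⟩
      I.b₂ + ι (+ 12) * r                                                  ∎
      where
      open ≡-Reasoning
      scale : ∀ u a₁ a₂ → u * u * (a₁ * a₁ + ι (+ 4) * a₂)
                          ≡ u * a₁ * (u * a₁) + ι (+ 4) * (u * u * a₂)
      scale = solve-∀ ℚ-ring
      expand : ∀ a₁ a₂ r s →
        (a₁ + (s + s)) * (a₁ + (s + s)) + ι (+ 4) * (a₂ - s * a₁ + (r + r + r) - s * s)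
        ≡ a₁ * a₁ + ι (+ 4) * a₂ + ι (+ 12) * r
      expand = solve-∀ ℚ-ring

    b₄-transform : fourth u * I′.b₄ ≡ I.b₄ + r * I.b₂ + ι (+ 6) * r * r
    b₄-transform = begin
      fourth u * I′.b₄                        ≡⟨ scale u a₁′ a₃′ a₄′ ⟩
      ι (+ 2) * (u * u * u * u * a₄′) + u * a₁′ * (u * u * u * a₃′)
        ≡⟨ cong₂ (λ x y → ι (+ 2) * x + y) eq₄ (cong₂ _*_ eq₁ eq₃) ⟩
      _                                       ≡⟨ expand a₁ a₂ a₃ a₄ r s t ⟩
      I.b₄ + r * I.b₂ + ι (+ 6) * r * r       ∎
      where
      open ≡-Reasoning
      scale : ∀ u a₁ a₃ a₄ → u * u * (u * u) * (ι (+ 2) * a₄ + a₁ * a₃)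
                          ≡ ι (+ 2) * (u * u * u * u * a₄) + u * a₁ * (u * u * u * a₃)
      scale = solve-∀ ℚ-ring
      expand : ∀ a₁ a₂ a₃ a₄ r s t →
        ι (+ 2) * (a₄ - s * a₃ + (r + r) * a₂ - (t + r * s) * a₁
                    + (r + r + r) * r - (s + s) * t)
          + (a₁ + (s + s)) * (a₃ + r * a₁ + (t + t))
        ≡ ι (+ 2) * a₄ + a₁ * a₃ + r * (a₁ * a₁ + ι (+ 4) * a₂) + ι (+ 6) * r * r
      expand = solve-∀ ℚ-ring

    b₆-transform : cube (u * u) * I′.b₆
      ≡ I.b₆ + ι (+ 2) * r * I.b₄ + r * r * I.b₂ + ι (+ 4) * r * r * r
    b₆-transform = begin
      cube (u * u) * I′.b₆                    ≡⟨ scale u a₃′ a₆′ ⟩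
      u * u * u * a₃′ * (u * u * u * a₃′) + ι (+ 4) * (u * u * u * u * u * u * a₆′)
        ≡⟨ cong₂ (λ x y → x * x + ι (+ 4) * y) eq₃ eq₆ ⟩
      _                                       ≡⟨ expand a₁ a₂ a₃ a₄ a₆ r t ⟩
      I.b₆ + ι (+ 2) * r * I.b₄ + r * r * I.b₂ + ι (+ 4) * r * r * r ∎
      where
      open ≡-Reasoning
      scale : ∀ u a₃ a₆ → u * u * (u * u) * (u * u) * (a₃ * a₃ + ι (+ 4) * a₆)
        ≡ u * u * u * a₃ * (u * u * u * a₃) + ι (+ 4) * (u * u * u * u * u * u * a₆)
      scale = solve-∀ ℚ-ring
      expand : ∀ a₁ a₂ a₃ a₄ a₆ r t →
        (a₃ + r * a₁ + (t + t)) * (a₃ + r * a₁ + (t + t))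
          + ι (+ 4) * (a₆ + r * a₄ + r * r * a₂ + r * r * r - t * a₃ - t * t - r * t * a₁)
        ≡ a₃ * a₃ + ι (+ 4) * a₆ + ι (+ 2) * r * (ι (+ 2) * a₄ + a₁ * a₃)
          + r * r * (a₁ * a₁ + ι (+ 4) * a₂) + ι (+ 4) * r * r * r
      expand = solve-∀ ℚ-ring

    c₄-transform : fourth u * c₄ W′ ≡ c₄ W
    c₄-transform = begin
      fourth u * c₄ W′                                       ≡⟨ scale u I′.b₂ I′.b₄ ⟩
      u * u * I′.b₂ * (u * u * I′.b₂) - ι (+ 24) * (fourth u * I′.b₄)
        ≡⟨ cong₂ (λ x y → x * x - ι (+ 24) * y) b₂-transform b₄-transform ⟩
      _                                                      ≡⟨ expand r I.b₂ I.b₄ ⟩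
      c₄ W                                                   ∎
      where
      open ≡-Reasoning
      scale : ∀ u b₂ b₄ → u * u * (u * u) * (b₂ * b₂ - ι (+ 24) * b₄)
        ≡ u * u * b₂ * (u * u * b₂) - ι (+ 24) * (u * u * (u * u) * b₄)
      scale = solve-∀ ℚ-ring
      expand : ∀ r b₂ b₄ →
        (b₂ + ι (+ 12) * r) * (b₂ + ι (+ 12) * r)
          - ι (+ 24) * (b₄ + r * b₂ + ι (+ 6) * r * r)
        ≡ b₂ * b₂ - ι (+ 24) * b₄
      expand = solve-∀ ℚ-ring

    -- `s` and `t` have already disappeared from the bᵢ; `discriminantForm` is weighted homogeneous,
    -- which accounts for `u`, and invariant under the translation by `r`.
    Δ-transform : twelfth u * I′.Δ ≡ I.Δ
    Δ-transform = *-cancelˡ (ι (+ 4)) (λ ()) (begin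
      ι (+ 4) * (twelfth u * I′.Δ)         ≡⟨ exchange (ι (+ 4)) (twelfth u) I′.Δ ⟩
      twelfth u * (ι (+ 4) * I′.Δ)         ≡⟨ cong (twelfth u *_) (4Δ W′) ⟩
      twelfth u * discriminantForm I′.b₂ I′.b₄ I′.b₆   ≡⟨ scale (u * u) I′.b₂ I′.b₄ I′.b₆ ⟩
      discriminantForm (u * u * I′.b₂) (fourth u * I′.b₄) (cube (u * u) * I′.b₆)
        ≡⟨ form-cong b₂-transform b₄-transform b₆-transform ⟩
      _                                    ≡⟨ expand r I.b₂ I.b₄ I.b₆ ⟩
      discriminantForm I.b₂ I.b₄ I.b₆      ≡⟨ 4Δ W ⟨
      ι (+ 4) * I.Δ                        ∎)
      where
      open ≡-Reasoning
      form-cong : ∀ {x x′ y y′ z z′} → x ≡ x′ → y ≡ y′ → z ≡ z′ →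
                  discriminantForm x y z ≡ discriminantForm x′ y′ z′
      form-cong refl refl refl = refl
      exchange : ∀ x y z → x * (y * z) ≡ y * (x * z)
      exchange = solve-∀ ℚ-ring
      scale : ∀ v b₂ b₄ b₆ →
        v * v * (v * v) * (v * v) *
        (- (b₂ * b₂ * (b₂ * b₆ - b₄ * b₄)) - ι (+ 32) * b₄ * b₄ * b₄ - ι (+ 108) * b₆ * b₆
          + ι (+ 36) * b₂ * b₄ * b₆)
        ≡ - (v * b₂ * (v * b₂) * (v * b₂ * (v * v * v * b₆) - v * v * b₄ * (v * v * b₄)))
          - ι (+ 32) * (v * v * b₄) * (v * v * b₄) * (v * v * b₄)
          - ι (+ 108) * (v * v * v * b₆) * (v * v * v * b₆)
          + ι (+ 36) * (v * b₂) * (v * v * b₄) * (v * v * v * b₆)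
      scale = solve-∀ ℚ-ring
      expand : ∀ r b₂ b₄ b₆ →
        let c₂ = b₂ + ι (+ 12) * r
            c₄ = b₄ + r * b₂ + ι (+ 6) * r * r
            c₆ = b₆ + ι (+ 2) * r * b₄ + r * r * b₂ + ι (+ 4) * r * r * r
        in - (c₂ * c₂ * (c₂ * c₆ - c₄ * c₄)) - ι (+ 32) * c₄ * c₄ * c₄ - ι (+ 108) * c₆ * c₆
             + ι (+ 36) * c₂ * c₄ * c₆
           ≡ - (b₂ * b₂ * (b₂ * b₆ - b₄ * b₄)) - ι (+ 32) * b₄ * b₄ * b₄ - ι (+ 108) * b₆ * b₆
             + ι (+ 36) * b₂ * b₄ * b₆
      expand = solve-∀ ℚ-ring

  ↥↧ : ∀ q → q * ι (↧ q) ≡ ι (↥ q)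
  ↥↧ q@(mkℚ n d-1 _) = ℚ.toℚᵘ-injective (begin
    toℚᵘ (q * ι (↧ q))             ≈⟨ ℚ.toℚᵘ-homo-* q (ι (↧ q)) ⟩
    toℚᵘ q ℚᵘ.* toℚᵘ (ι (↧ q))     ≈⟨ ℚᵘ.*-congˡ {toℚᵘ q} (ℚ.toℚᵘ-fromℚᵘ (ℚᵘ.mkℚᵘ (↧ q) 0)) ⟩
    toℚᵘ q ℚᵘ.* ℚᵘ.mkℚᵘ (↧ q) 0    ≈⟨ ℚᵘ.*≡* (cancel n (↧ q) (cong (λ d → + suc d) (ℕ.*-identityʳ d-1))) ⟩
    ℚᵘ.mkℚᵘ n 0                    ≈⟨ ℚ.toℚᵘ-fromℚᵘ (ℚᵘ.mkℚᵘ n 0) ⟨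
    toℚᵘ (ι n)                     ∎)
    where
    open ℚᵘ.≃-Reasoning
    cancel : ∀ n d {d′} → d′ ≡ d → n ℤ.* d ℤ.* + 1 ≡ n ℤ.* d′
    cancel n d refl = ℤ.*-identityʳ (n ℤ.* d)

  -- Two integral models of the same curve

  c₄ℤ : Weierstrass ℤ → ℤ
  c₄ℤ W = b₂ ℤ.* b₂ ℤ.- + 24 ℤ.* b₄
    where open Invariants ℤ.+-*-rawRing W

  ι-c₄ : ∀ W → c₄ (toℚ W) ≈ι c₄ℤ W
  ι-c₄ W = ι-b₂ W ⊠ ι-b₂ W ⊟ cast (+ 24) ⊠ ι-b₄ W

  fourthℤ twelfthℤ : ℤ → ℤ
  fourthℤ  x = x ℤ.* x ℤ.* (x ℤ.* x)
  twelfthℤ x = fourthℤ x ℤ.* fourthℤ x ℤ.* fourthℤ x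

  ι-fourth : ∀ x → fourth (ι x) ≈ι fourthℤ x
  ι-fourth x = cast x ⊠ cast x ⊠ (cast x ⊠ cast x)

  ι-twelfth : ∀ x → twelfth (ι x) ≈ι twelfthℤ x
  ι-twelfth x = ι-fourth x ⊠ ι-fourth x ⊠ ι-fourth x

  fourth-* : ∀ x y → fourth (x * y) ≡ fourth x * fourth y
  fourth-* = identity
    where
    identity : ∀ x y → x * y * (x * y) * (x * y * (x * y)) ≡ x * x * (x * x) * (y * y * (y * y))
    identity = solve-∀ ℚ-ring

  twelfth-* : ∀ x y → twelfth (x * y) ≡ twelfth x * twelfth y
  twelfth-* x y = trans (cong cube (fourth-* x y)) (identity (fourth x) (fourth y))
    where
    identity : ∀ x y → x * y * (x * y) * (x * y) ≡ x * x * x * (y * y * y)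
    identity = solve-∀ ℚ-ring

  fourth-≢0 : ∀ {x} → x ≢ 0ℚ → fourth x ≢ 0ℚ
  fourth-≢0 x≢0 = *-≢0 (*-≢0 x≢0 x≢0) (*-≢0 x≢0 x≢0)

  twelfth-≢0 : ∀ {x} → x ≢ 0ℚ → twelfth x ≢ 0ℚ
  twelfth-≢0 x≢0 = *-≢0 (*-≢0 (fourth-≢0 x≢0) (fourth-≢0 x≢0)) (fourth-≢0 x≢0)

  module _ (f : ℚ → ℚ) (fℤ : ℤ → ℤ) (ι-f : ∀ x → f (ι x) ≈ι fℤ x)
           (f-* : ∀ x y → f (x * y) ≡ f x * f y) (f-≢0 : ∀ {x} → x ≢ 0ℚ → f x ≢ 0ℚ) where

    -- `f` is the fourth or twelfth power, the weights of c₄ and Δ. Only the ratio ρ = w / u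
    -- matters, and as a rational in lowest terms it turns the relation into one between integers
    -- with coprime factors.
    clearDenominators : ∀ ρ {u w x y i j} → u ≢ 0ℚ → ρ * u ≡ w → x ≈ι i → y ≈ι j →
      f u * x ≡ f w * y → fℤ (↧ ρ) ℤ.* i ≡ fℤ (↥ ρ) ℤ.* j
    clearDenominators ρ {u} {w} {x} {y} {i} {j} u≢0 ρu≡w x≈i y≈j fu*x≡fw*y =
      ι-injective (begin
        ι (fℤ (↧ ρ) ℤ.* i)        ≡⟨ equal (ι-f (↧ ρ) ⊠ x≈i) ⟨
        f (ι (↧ ρ)) * x           ≡⟨ cong (f (ι (↧ ρ)) *_) x≡fρ*y ⟩
        f (ι (↧ ρ)) * (f ρ * y)   ≡⟨ regroup (f (ι (↧ ρ))) (f ρ) y ⟩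
        f ρ * f (ι (↧ ρ)) * y     ≡⟨ cong (_* y) (trans (sym (f-* ρ (ι (↧ ρ)))) (cong f (↥↧ ρ))) ⟩
        f (ι (↥ ρ)) * y           ≡⟨ equal (ι-f (↥ ρ) ⊠ y≈j) ⟩
        ι (fℤ (↥ ρ) ℤ.* j)        ∎)
      where
      open ≡-Reasoning
      regroup : ∀ a b c → a * (b * c) ≡ b * a * c
      regroup = solve-∀ ℚ-ring
      x≡fρ*y : x ≡ f ρ * y
      x≡fρ*y = *-cancelˡ (f u) (f-≢0 u≢0) (begin
        f u * x            ≡⟨ fu*x≡fw*y ⟩
        f w * y            ≡⟨ cong (λ z → f z * y) ρu≡w ⟨
        f (ρ * u) * y      ≡⟨ cong (_* y) (f-* ρ u) ⟩
        f ρ * f u * y      ≡⟨ regroup (f u) (f ρ) y ⟨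
        f u * (f ρ * y)    ∎)

  Δℤ : Weierstrass ℤ → ℤ
  Δℤ W = Invariants.Δ ℤ.+-*-rawRing W

  compareModels : ∀ {W V V′} → ChangeOfVariables W (toℚ V) → ChangeOfVariables W (toℚ V′) →
    ∃[ ρ ] twelfthℤ (↧ ρ) ℤ.* Δℤ V ≡ twelfthℤ (↥ ρ) ℤ.* Δℤ V′ ×
           fourthℤ (↧ ρ) ℤ.* c₄ℤ V ≡ fourthℤ (↥ ρ) ℤ.* c₄ℤ V′
  compareModels {V = V} {V′} C C′ with divide (ChangeOfVariables.u C′) (ChangeOfVariables.u≢0 C)
  ... | ρ , ρu≡u′ = ρ ,
    clearDenominators twelfth twelfthℤ ι-twelfth twelfth-* twelfth-≢0 ρ u≢0 ρu≡u′ (ι-Δ V) (ι-Δ V′)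
      (trans (Δ-transform C) (sym (Δ-transform C′))) ,
    clearDenominators fourth fourthℤ ι-fourth fourth-* fourth-≢0 ρ u≢0 ρu≡u′ (ι-c₄ V) (ι-c₄ V′)
      (trans (c₄-transform C) (sym (c₄-transform C′)))
    where open ChangeOfVariables C using (u≢0)

open RationalModels

-- Bad reduction of the curves in the family, read off from Δ and c₄

module IntegralModels where
  open import Data.Integer.Base using (_+_; _-_; _*_; -_)
  open import Data.Integer.Tactic.RingSolver using (solve-∀)

  -- Prime divisors of integers

  module _ {p : ℕ} (p-prime : Prime p) where

    prime-* : ∀ x y → + p ∣ℤ x * y → + p ∣ℤ x ⊎ + p ∣ℤ y
    prime-* x y p∣xy
      with euclidsLemma ∣ x ∣ ∣ y ∣ p-prime (subst (p ℕ.∣_) (ℤ.abs-* x y) (∣⇒∣ᵤ p∣xy))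
    ... | inj₁ p∣x = inj₁ (∣ᵤ⇒∣ p∣x)
    ... | inj₂ p∣y = inj₂ (∣ᵤ⇒∣ p∣y)

    prime-square : ∀ x → + p ∣ℤ x * x → + p ∣ℤ x
    prime-square x p∣xx = [ id , id ]′ (prime-* x x p∣xx)

    prime-fourth : ∀ x → + p ∣ℤ fourthℤ x → + p ∣ℤ x
    prime-fourth x p∣x⁴ = prime-square x (prime-square (x * x) p∣x⁴)

    prime-twelfth : ∀ x → + p ∣ℤ twelfthℤ x → + p ∣ℤ x
    prime-twelfth x p∣x¹² with prime-* (fourthℤ x * fourthℤ x) (fourthℤ x) p∣x¹²
    ... | inj₁ p∣x⁸ = prime-fourth x (prime-square (fourthℤ x) p∣x⁸)
    ... | inj₂ p∣x⁴ = prime-fourth x p∣x⁴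

    prime-cancel : ∀ x y → ¬ + p ∣ℤ x → + p ∣ℤ x * y → + p ∣ℤ y
    prime-cancel x y p∤x p∣xy with prime-* x y p∣xy
    ... | inj₁ p∣x = contradiction p∣x p∤x
    ... | inj₂ p∣y = p∣y

    instance
      p≢0 : ℤ.NonZero (+ p)
      p≢0 = ℤ.≢-nonZero {+ p} (λ { refl → ¬prime[0] p-prime })

    prime²-cancel : ∀ x y → ¬ + p ∣ℤ x → + p * + p ∣ℤ x * y → + p * + p ∣ℤ y
    prime²-cancel x y p∤x p²∣xy@(divides q eq)
      with prime-cancel x y p∤x (∣-trans (divides (+ p) refl) p²∣xy)
    ... | divides y′ refl
      with prime-cancel x y′ p∤x (divides q (ℤ.*-cancelʳ-≡ (x * y′) (q * + p) (+ p)
             (trans (ℤ.*-assoc x y′ (+ p)) (trans eq (sym (ℤ.*-assoc q (+ p) (+ p)))))))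
    ... | divides y″ refl = divides y″ (ℤ.*-assoc y″ (+ p) (+ p))

    coprime-∤ : ∀ x y → Coprime ∣ x ∣ ∣ y ∣ → + p ∣ℤ x → ¬ + p ∣ℤ y
    coprime-∤ x y coprime p∣x p∣y =
      contradiction (subst Prime (coprime (∣⇒∣ᵤ p∣x , ∣⇒∣ᵤ p∣y)) p-prime) ¬prime[1]

    square-∣ : ∀ x → + p ∣ℤ x → + p * + p ∣ℤ x * x
    square-∣ _ (divides q refl) = divides (q * q) (square q (+ p))
      where
      square : ∀ q p → q * p * (q * p) ≡ q * q * (p * p)
      square = solve-∀

    -- Since `p` divides D but not D′, it divides the numerator s of ρ, hence not the denominator t;
    -- the factor s⁴ on the right then passes to `c`.
    unit-scaling : ∀ ρ D D′ c c′ →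
      twelfthℤ (↧ ρ) * D ≡ twelfthℤ (↥ ρ) * D′ → fourthℤ (↧ ρ) * c ≡ fourthℤ (↥ ρ) * c′ →
      ¬ + p ∣ℤ D′ → + p ∣ℤ D → + p * + p ∣ℤ c
    unit-scaling (mkℚ s t-1 s⊥t) D D′ c c′ t¹²D≡s¹²D′ t⁴c≡s⁴c′ p∤D′ p∣D =
      prime²-cancel (fourthℤ t) c p∤t⁴
        (subst (+ p * + p ∣ℤ_) (sym t⁴c≡s⁴c′) (∣m⇒∣m*n c′ (∣m⇒∣m*n (s * s) (square-∣ s p∣s))))
      where
      t : ℤ
      t = + suc t-1
      p∣s : + p ∣ℤ s
      p∣s = prime-twelfth s ([ id , (λ p∣D′ → contradiction p∣D′ p∤D′) ]′
        (prime-* (twelfthℤ s) D′ (subst (+ p ∣ℤ_) t¹²D≡s¹²D′ (∣n⇒∣m*n (twelfthℤ t) p∣D))))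
      p∤t⁴ : ¬ + p ∣ℤ fourthℤ t
      p∤t⁴ p∣t⁴ = coprime-∤ s t (ℕ.recompute s⊥t) p∣s (prime-fourth t p∣t⁴)

    goodModel⇒p²∣c₄ : ∀ E → GoodModel E p → ∀ V → IntegralModel E V →
      + p ∣ℤ Δℤ V → + p * + p ∣ℤ c₄ℤ V
    goodModel⇒p²∣c₄ E (W , C′ , p∤Δ) V C p∣Δ =
      let (ρ , t¹²Δ≡s¹²Δ′ , t⁴c≡s⁴c′) = compareModels {EllipticCurve.equation E} {V} {W} C C′
      in unit-scaling ρ (Δℤ V) (Δℤ W) (c₄ℤ V) (c₄ℤ W) t¹²Δ≡s¹²Δ′ t⁴c≡s⁴c′ p∤Δ p∣Δ

  -- Curves with a₄ = a₆ = 0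

  tangentForm : ℤ → ℤ → ℤ → Weierstrass ℤ
  tangentForm a₁ a₂ a₃ = weierstrass a₁ a₂ a₃ 0ℤ 0ℤ

  module _ (a₁ a₂ a₃ : ℤ) where

    c₄-tangentForm : c₄ℤ (tangentForm a₁ a₂ a₃) ≡
      (a₁ * a₁ + + 4 * a₂) * (a₁ * a₁ + + 4 * a₂) - + 24 * (a₁ * a₃)
    c₄-tangentForm = cong (λ b₄ → (a₁ * a₁ + + 4 * a₂) * (a₁ * a₁ + + 4 * a₂) - + 24 * b₄)
      (ℤ.+-identityˡ (a₁ * a₃))

    -- Modulo a₃ the point (0 , 0) is singular; algebraically, b₄ = a₁a₃, b₆ = a₃² and b₈ = a₂a₃²
    -- are all multiples of a₃.
    a₃∣Δ-tangentForm : a₃ ∣ℤ Δℤ (tangentForm a₁ a₂ a₃)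
    a₃∣Δ-tangentForm = divides (cofactor a₁ a₂ a₃) (identity a₁ a₂ a₃)
      where
      cofactor : ℤ → ℤ → ℤ → ℤ
      cofactor a₁ a₂ a₃ =
        let b₂ = a₁ * a₁ + + 4 * a₂
        in - (b₂ * b₂ * a₂ * a₃) - + 8 * (a₁ * a₁ * a₁ * a₃ * a₃) - + 27 * (a₃ * a₃ * a₃)
           + + 9 * (b₂ * a₁ * a₃ * a₃)
      identity : ∀ a₁ a₂ a₃ →
        let b₂ = a₁ * a₁ + + 4 * a₂
            b₄ = + 0 + a₁ * a₃
            b₆ = a₃ * a₃ + + 0
            b₈ = a₁ * a₁ * + 0 + + 4 * a₂ * + 0 - a₁ * a₃ * + 0 + a₂ * a₃ * a₃ - + 0
        in - (b₂ * b₂ * b₈) - + 8 * b₄ * b₄ * b₄ - + 27 * b₆ * b₆ + + 9 * b₂ * b₄ * b₆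
           ≡ (- (b₂ * b₂ * a₂ * a₃) - + 8 * (a₁ * a₁ * a₁ * a₃ * a₃) - + 27 * (a₃ * a₃ * a₃)
               + + 9 * (b₂ * a₁ * a₃ * a₃)) * a₃
      identity = solve-∀

  ∣-lin₁ : ∀ {k} a {x z} → k ∣ℤ x → z ≡ a * x → k ∣ℤ z
  ∣-lin₁ a k∣x refl = ∣n⇒∣m*n a k∣x

  ∣-lin₂ : ∀ {k} a b {x y z} → k ∣ℤ x → k ∣ℤ y → z ≡ a * x + b * y → k ∣ℤ z
  ∣-lin₂ a b k∣x k∣y refl = ∣m∣n⇒∣m+n (∣n⇒∣m*n a k∣x) (∣n⇒∣m*n b k∣y)

  product-∣ : ∀ {k l x y} → k ∣ℤ x → l ∣ℤ y → k * l ∣ℤ x * y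
  product-∣ {k} {l} (divides q refl) (divides r refl) = divides (q * r) (interchange q k r l)
    where open import Algebra.Properties.CommutativeSemigroup ℤ.*-commutativeSemigroup

  module _ {p : ℕ} (p-prime : Prime p) where

    p∣b₂ : ∀ a₁ a₂ a₃ → + p ∣ℤ a₃ → + p ∣ℤ c₄ℤ (tangentForm a₁ a₂ a₃) →
      + p ∣ℤ a₁ * a₁ + + 4 * a₂
    p∣b₂ a₁ a₂ a₃ p∣a₃ p∣c₄ = prime-square p-prime _
      (∣-lin₂ (+ 1) (+ 24 * a₁) (subst (+ p ∣ℤ_) (c₄-tangentForm a₁ a₂ a₃) p∣c₄) p∣a₃
        (identity (a₁ * a₁ + + 4 * a₂) a₁ a₃))
      where
      identity : ∀ b₂ a₁ a₃ →
        b₂ * b₂ ≡ + 1 * (b₂ * b₂ - + 24 * (a₁ * a₃)) + + 24 * a₁ * a₃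
      identity = solve-∀

    p∣a₁ : ∀ a₁ a₂ a₃ → + p ∣ℤ + 4 * a₂ → + p ∣ℤ a₃ →
      + p ∣ℤ c₄ℤ (tangentForm a₁ a₂ a₃) → + p ∣ℤ a₁
    p∣a₁ a₁ a₂ a₃ p∣4a₂ p∣a₃ p∣c₄ = prime-square p-prime a₁
      (∣-lin₂ (+ 1) (- + 1) (p∣b₂ a₁ a₂ a₃ p∣a₃ p∣c₄) p∣4a₂ (identity (a₁ * a₁) (+ 4 * a₂)))
      where
      identity : ∀ x y → x ≡ + 1 * (x + y) + - + 1 * y
      identity = solve-∀

  -- The curves with a point of order 10

  -- For e = m / n these are n² γ(e) and n² β(e), where
  -- γ(e) = 3e - e² - 1 and β(e) = (2e - 1)(e - 1). They are opaque since Agda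
  -- would otherwise unfold integer multiplication in the curves below.
  opaque
    G B : ℤ → ℤ → ℤ
    G m n = + 3 * m * n - m * m - n * n
    B m n = (+ 2 * m - n) * (m - n)

    n²-as-combination : ∀ m n → n * n ≡ (+ 3 * n - m) * m + - + 1 * G m n
    n²-as-combination = identity
      where
      identity : ∀ m n → n * n ≡ (+ 3 * n - m) * m + - + 1 * (+ 3 * m * n - m * m - n * n)
      identity = solve-∀

    m²-as-combination : ∀ m n → m * m ≡ + 1 * B m n + + 1 * G m n
    m²-as-combination = identity
      where
      identity : ∀ m n → m * m ≡
        + 1 * ((+ 2 * m - n) * (m - n)) + + 1 * (+ 3 * m * n - m * m - n * n)
      identity = solve-∀

    2m²-as-combination : ∀ m n → + 2 * (m * m) ≡ + 1 * B m n + (+ 3 * m - n) * n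
    2m²-as-combination = identity
      where
      identity : ∀ m n → + 2 * (m * m) ≡ + 1 * ((+ 2 * m - n) * (m - n)) + (+ 3 * m - n) * n
      identity = solve-∀

    m²-as-combination′ : ∀ m n → m * m ≡ (+ 3 * m - n) * n + - + 1 * G m n
    m²-as-combination′ = identity
      where
      identity : ∀ m n → m * m ≡ (+ 3 * m - n) * n + - + 1 * (+ 3 * m * n - m * m - n * n)
      identity = solve-∀

    -- The form -G = m² - 3mn + n² takes the value 5n² at m = 4n. Modulo its discriminant 5 it is
    -- the square of m + n, which is there the same as m - 4n.
    5n²-as-combination : ∀ m n → + 5 * (n * n) ≡ - (m + n) * (m - + 4 * n) + - + 1 * G m n
    5n²-as-combination = identity
      where
      identity : ∀ m n → + 5 * (n * n) ≡
        - (m + n) * (m - + 4 * n) + - + 1 * (+ 3 * m * n - m * m - n * n)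
      identity = solve-∀

    m²-4mn-as-combination : ∀ m n → m * (m - + 4 * n) ≡ + 1 * (B m n - + 4 * (n * m)) + + 1 * G m n
    m²-4mn-as-combination = identity
      where
      identity : ∀ m n → m * (m - + 4 * n) ≡
        + 1 * ((+ 2 * m - n) * (m - n) - + 4 * (n * m)) + + 1 * (+ 3 * m * n - m * m - n * n)
      identity = solve-∀

  -- Kubert's Tate normal form b = c d, c = e (d - 1), d = e² / γ(e), scaled by
  -- n G to clear denominators.
  curve : ℤ → ℤ → Weierstrass ℤ
  curve m n = tangentForm (n * G m n - m * B m n)
                          (- (n * (m * m * m) * B m n))
                          (- (n * n * G m n * (m * m * m) * B m n))

  opaque
    -- These are `G m (2 k)` and one half of `B m (2 k)`. The factor 2 of `B`, with those of n = 2k,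
    -- allows a₁, a₂, a₃ to be divided by 2, 4, 8.
    G-even B-even : ℤ → ℤ → ℤ
    G-even m k = + 6 * m * k - m * m - + 4 * k * k
    B-even m k = (m - k) * (m - + 2 * k)

    B-even-as-combination : ∀ m k → B-even m k ≡ (m - + 2 * k) * (m - k)
    B-even-as-combination m k = ℤ.*-comm (m - k) (m - + 2 * k)

    m²-via-B-even : ∀ m k → m * m ≡ + 1 * B-even m k + (+ 3 * m - + 2 * k) * k
    m²-via-B-even = identity
      where
      identity : ∀ m k → m * m ≡ + 1 * ((m - k) * (m - + 2 * k)) + (+ 3 * m - + 2 * k) * k
      identity = solve-∀

    m²-via-G-even : ∀ m k → m * m ≡ - + 1 * G-even m k + (+ 3 * m * k - + 2 * k * k) * + 2
    m²-via-G-even = identity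
      where
      identity : ∀ m k → m * m ≡
        - + 1 * (+ 6 * m * k - m * m - + 4 * k * k) + (+ 3 * m * k - + 2 * k * k) * + 2
      identity = solve-∀

  -- The model obtained from curve m (2 k) by scaling with u = 2.
  curve-even : ℤ → ℤ → Weierstrass ℤ
  curve-even m k = tangentForm (k * G-even m k - m * B-even m k)
                               (- (k * (m * m * m) * B-even m k))
                               (- (k * k * G-even m k * (m * m * m) * B-even m k))

  badDivisor : ℤ → ℤ → ℤ
  badDivisor m n = n * m * B m n * G m n

  module _ {p : ℕ} (p-prime : Prime p) (m n : ℤ) (m⊥n : + p ∣ℤ m → ¬ + p ∣ℤ n) where
    private
      g b a₁ : ℤ
      g  = G m n
      b  = B m n
      a₁ = n * g - m * b

    p∣m,g⇒p∣n : + p ∣ℤ m → + p ∣ℤ g → + p ∣ℤ n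
    p∣m,g⇒p∣n p∣m p∣g = prime-square p-prime n
      (∣-lin₂ (+ 3 * n - m) (- + 1) p∣m p∣g (n²-as-combination m n))

    p∣b,g⇒p∣m : + p ∣ℤ b → + p ∣ℤ g → + p ∣ℤ m
    p∣b,g⇒p∣m p∣b p∣g = prime-square p-prime m
      (∣-lin₂ (+ 1) (+ 1) p∣b p∣g (m²-as-combination m n))

    p∤g∧m : + p ∣ℤ g → ¬ + p ∣ℤ m
    p∤g∧m p∣g p∣m = m⊥n p∣m (p∣m,g⇒p∣n p∣m p∣g)

    p∤g∧b : + p ∣ℤ g → ¬ + p ∣ℤ b
    p∤g∧b p∣g p∣b = p∤g∧m p∣g (p∣b,g⇒p∣m p∣b p∣g)

    module _ (¬both-even : + p ∣ℤ + 2 → ¬ + p ∣ℤ n) where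

      -- Modulo n the form `B` is 2m², so apart from 2 it is coprime to n.
      p∤n∧b : + p ∣ℤ n → ¬ + p ∣ℤ b
      p∤n∧b p∣n p∣b =
        [ (λ p∣2 → ¬both-even p∣2 p∣n)
        , (λ p∣m² → m⊥n (prime-square p-prime m p∣m²) p∣n) ]′
        (prime-* p-prime (+ 2) (m * m)
          (∣-lin₂ (+ 1) (+ 3 * m - n) p∣b p∣n (2m²-as-combination m n)))

      -- In a₁ = ng - mb, such a prime divides exactly one of the two terms.
      p∤nmb∧a₁ : + p ∣ℤ n * m * b → ¬ + p ∣ℤ a₁
      p∤nmb∧a₁ p∣nmb p∣a₁ =
        [ (λ p∣nm → [ p∤n∧a₁ , p∤m∧a₁ ]′ (prime-* p-prime n m p∣nm)) , p∤b∧a₁ ]′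
        (prime-* p-prime (n * m) b p∣nmb)
        where
        isolate-ng : ∀ n g m b → n * g ≡ + 1 * (n * g - m * b) + m * b
        isolate-ng = solve-∀
        isolate-ng′ : ∀ n g m b → n * g ≡ + 1 * (n * g - m * b) + b * m
        isolate-ng′ = solve-∀
        isolate-mb : ∀ n g m b → m * b ≡ - + 1 * (n * g - m * b) + g * n
        isolate-mb = solve-∀
        p∤b∧a₁ : ¬ + p ∣ℤ b
        p∤b∧a₁ p∣b = [ (λ p∣n → p∤n∧b p∣n p∣b) , (λ p∣g → p∤g∧b p∣g p∣b) ]′
          (prime-* p-prime n g (∣-lin₂ (+ 1) m p∣a₁ p∣b (isolate-ng n g m b)))
        p∤n∧a₁ : ¬ + p ∣ℤ n
        p∤n∧a₁ p∣n = [ (λ p∣m → m⊥n p∣m p∣n) , p∤n∧b p∣n ]′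
          (prime-* p-prime m b (∣-lin₂ (- + 1) g p∣a₁ p∣n (isolate-mb n g m b)))
        p∤m∧a₁ : ¬ + p ∣ℤ m
        p∤m∧a₁ p∣m = [ m⊥n p∣m , (λ p∣g → p∤g∧m p∣g p∣m) ]′
          (prime-* p-prime n g (∣-lin₂ (+ 1) b p∣a₁ p∣m (isolate-ng′ n g m b)))

      -- Both a₂ and a₃ are multiples of nmb, so c₄ is a₁⁴ modulo `p`: the reduction is
      -- multiplicative.
      p∣nmb⇒p∤c₄ : + p ∣ℤ n * m * b → ¬ + p ∣ℤ c₄ℤ (curve m n)
      p∣nmb⇒p∤c₄ p∣nmb p∣c₄ = p∤nmb∧a₁ p∣nmb
        (p∣a₁ p-prime a₁ (- (n * (m * m * m) * b)) (- (n * n * g * (m * m * m) * b))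
          (∣-lin₁ (- (+ 4 * (m * m))) p∣nmb (identity₂ n m b))
          (∣-lin₁ (- (n * g * (m * m))) p∣nmb (identity₃ n m b g)) p∣c₄)
        where
        identity₂ : ∀ n m b → + 4 * - (n * (m * m * m) * b) ≡ - (+ 4 * (m * m)) * (n * m * b)
        identity₂ = solve-∀
        identity₃ : ∀ n m b g →
          - (n * n * g * (m * m * m) * b) ≡ - (n * g * (m * m)) * (n * m * b)
        identity₃ = solve-∀

    module _ (p∣g : + p ∣ℤ g) where
      private
        a₂ a₃ b₂ : ℤ
        a₂ = - (n * (m * m * m) * b)
        a₃ = - (n * n * g * (m * m * m) * b)
        b₂ = a₁ * a₁ + + 4 * a₂

      p∤m : ¬ + p ∣ℤ m
      p∤m = p∤g∧m p∣g

      p∤b : ¬ + p ∣ℤ b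
      p∤b = p∤g∧b p∣g

      p∤n : ¬ + p ∣ℤ n
      p∤n p∣n = p∤m (prime-square p-prime m
        (∣-lin₂ (+ 3 * m - n) (- + 1) p∣n p∣g (m²-as-combination′ m n)))

      p∤a₁ : ¬ + p ∣ℤ a₁
      p∤a₁ p∣a₁ = [ p∤m , p∤b ]′ (prime-* p-prime m b
        (∣-lin₂ (- + 1) n p∣a₁ p∣g (identity n g m b)))
        where
        identity : ∀ n g m b → m * b ≡ - + 1 * (n * g - m * b) + n * g
        identity = solve-∀

      -- Modulo g one has a₁ = -mb, hence b₂ = m²b(b - 4nm), and b = m² turns the last factor into
      -- m(m - 4n).
      p∣m-4n : + p ∣ℤ b₂ → + p ∣ℤ m - + 4 * n
      p∣m-4n p∣b₂ = prime-cancel p-prime m (m - + 4 * n) p∤m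
        (∣-lin₂ (+ 1) (+ 1) p∣b-4nm p∣g (m²-4mn-as-combination m n))
        where
        identity : ∀ n g m b → m * m * b * (b - + 4 * (n * m)) ≡
          + 1 * ((n * g - m * b) * (n * g - m * b) + + 4 * - (n * (m * m * m) * b))
            + (+ 2 * n * m * b - n * n * g) * g
        identity = solve-∀
        p∤m²b : ¬ + p ∣ℤ m * m * b
        p∤m²b p∣m²b = [ (λ p∣m² → p∤m (prime-square p-prime m p∣m²)) , p∤b ]′
          (prime-* p-prime (m * m) b p∣m²b)
        p∣b-4nm : + p ∣ℤ b - + 4 * (n * m)
        p∣b-4nm = prime-cancel p-prime (m * m * b) (b - + 4 * (n * m)) p∤m²b
          (∣-lin₂ (+ 1) (+ 2 * n * m * b - n * n * g) p∣b₂ p∣g (identity n g m b))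

      p∣5 : + p ∣ℤ m - + 4 * n → + p ∣ℤ + 5
      p∣5 p∣m-4n = [ id , (λ p∣n² → contradiction (prime-square p-prime n p∣n²) p∤n) ]′
        (prime-* p-prime (+ 5) (n * n)
          (∣-lin₂ (- (m + n)) (- + 1) p∣m-4n p∣g (5n²-as-combination m n)))

      p²∤5 : + p ∣ℤ + 5 → ¬ + p * + p ∣ℤ + 5
      p²∤5 p∣5 p²∣5 with prime⇒irreducible (from-yes (prime? 5)) (∣⇒∣ᵤ p∣5)
      ... | inj₁ refl = ¬prime[1] p-prime
      ... | inj₂ refl = from-no (+ 25 ∣? + 5) p²∣5

      -- Here `p` is 5 and divides both m - 4n and m + n, so g is -5n² modulo p², with n prime to
      -- `p`.
      p²∤g : + p ∣ℤ m - + 4 * n → ¬ + p * + p ∣ℤ g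
      p²∤g p∣m-4n p²∣g = p²∤5 (p∣5 p∣m-4n)
        (prime²-cancel p-prime (n * n) (+ 5) (p∤n ∘ prime-square p-prime n)
          (∣-lin₂ (- + 1) (- + 1) (product-∣ p∣m+n p∣m-4n) p²∣g
            (trans (ℤ.*-comm (n * n) (+ 5)) (trans (5n²-as-combination m n)
              (cong (_+ - + 1 * g) (identity (m + n) (m - + 4 * n)))))))
        where
        identity : ∀ x y → - x * y ≡ - + 1 * (x * y)
        identity = solve-∀
        identity₂ : ∀ m n → m + n ≡ + 1 * (m - + 4 * n) + n * + 5
        identity₂ = solve-∀
        p∣m+n : + p ∣ℤ m + n
        p∣m+n = ∣-lin₂ (+ 1) n p∣m-4n (p∣5 p∣m-4n) (identity₂ m n)

      -- If p² divided c₄ = b₂² - 24a₁a₃, then `p` would divide b₂, which forces p = 5. Removing b₂²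
      -- leaves 24a₁a₃, in which everything except g is prime to 5, so p² would divide g.
      p∣g⇒p²∤c₄ : ¬ + p * + p ∣ℤ c₄ℤ (curve m n)
      p∣g⇒p²∤c₄ p²∣c₄ = p²∤g (p∣m-4n p∣b₂′)
        (prime²-cancel p-prime cofactor g p∤cofactor
          (∣-lin₂ (+ 1) (- + 1) (subst (+ p * + p ∣ℤ_) (c₄-tangentForm a₁ a₂ a₃) p²∣c₄)
            (product-∣ p∣b₂′ p∣b₂′) (identity a₁ n m b g b₂)))
        where
        cofactor : ℤ
        cofactor = + 24 * a₁ * (n * n) * (m * m * m) * b
        identity : ∀ a₁ n m b g b₂ →
          + 24 * a₁ * (n * n) * (m * m * m) * b * g ≡
          + 1 * (b₂ * b₂ - + 24 * (a₁ * - (n * n * g * (m * m * m) * b))) + - + 1 * (b₂ * b₂)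
        identity = solve-∀
        identity₃ : ∀ n m b g →
          - (n * n * g * (m * m * m) * b) ≡ - (n * n * (m * m * m) * b) * g
        identity₃ = solve-∀
        p∣b₂′ : + p ∣ℤ b₂
        p∣b₂′ = p∣b₂ p-prime a₁ a₂ a₃ (∣-lin₁ (- (n * n * (m * m * m) * b)) p∣g (identity₃ n m b g))
          (∣-trans (divides (+ p) refl) p²∣c₄)
        p∤24 : ¬ + p ∣ℤ + 24
        p∤24 p∣24 = contradiction (subst Prime (ℕ.∣1⇒≡1 (∣⇒∣ᵤ p∣1)) p-prime) ¬prime[1]
          where
          p∣1 : + p ∣ℤ + 1
          -- 1 = 5 · 5 - 24.
          p∣1 = ∣-lin₂ (+ 5) (- + 1) (p∣5 (p∣m-4n p∣b₂′)) p∣24 refl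
        infixr 4 _∤*_
        _∤*_ : ∀ {x y} → ¬ + p ∣ℤ x → ¬ + p ∣ℤ y → ¬ + p ∣ℤ x * y
        _∤*_ {x} {y} p∤x p∤y p∣xy = [ p∤x , p∤y ]′ (prime-* p-prime x y p∣xy)
        p∤cofactor : ¬ + p ∣ℤ cofactor
        p∤cofactor = (((p∤24 ∤* p∤a₁) ∤* (p∤n ∤* p∤n)) ∤* ((p∤m ∤* p∤m) ∤* p∤m)) ∤* p∤b

  parity : ∀ x → + 2 ∣ℤ x ⊎ + 2 ∣ℤ x - + 1
  parity x with x ℤ.% + 2 in r≡ | ℤ.n%d<d x (+ 2) | ℤ.a≡a%n+[a/n]*n x (+ 2)
  ... | 0 | _ | x≡ = inj₁ (divides (x ℤ./ + 2) (trans x≡ (ℤ.+-identityˡ _)))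
  ... | 1 | _ | x≡ = inj₂ (divides (x ℤ./ + 2) (trans (cong (_- + 1) x≡) (cancel (x ℤ./ + 2 * + 2))))
    where
    cancel : ∀ y → + 1 + y - + 1 ≡ y
    cancel = solve-∀
  ... | suc (suc _) | s≤s (s≤s ()) | _

  odd-difference : ∀ x y → ¬ + 2 ∣ℤ x → ¬ + 2 ∣ℤ y → + 2 ∣ℤ x - y
  odd-difference x y 2∤x 2∤y with parity x | parity y
  ... | inj₁ 2∣x | _ = contradiction 2∣x 2∤x
  ... | inj₂ _   | inj₁ 2∣y = contradiction 2∣y 2∤y
  ... | inj₂ 2∣x-1 | inj₂ 2∣y-1 = ∣-lin₂ (+ 1) (- + 1) 2∣x-1 2∣y-1 (identity x y)
    where
    identity : ∀ x y → x - y ≡ + 1 * (x - + 1) + - + 1 * (y - + 1)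
    identity = solve-∀

  module _ (m k : ℤ) (2∤m : ¬ + 2 ∣ℤ m) where
    private
      g b a₁ a₂ a₃ : ℤ
      g  = G-even m k
      b  = B-even m k
      a₁ = k * g - m * b
      a₂ = - (k * (m * m * m) * b)
      a₃ = - (k * k * g * (m * m * m) * b)

    2∣k∨2∣m-k : + 2 ∣ℤ k ⊎ + 2 ∣ℤ m - k
    2∣k∨2∣m-k with + 2 ∣? k
    ... | yes 2∣k = inj₁ 2∣k
    ... | no 2∤k  = inj₂ (odd-difference m k 2∤m 2∤k)

    2∣b : + 2 ∣ℤ m - k → + 2 ∣ℤ b
    2∣b 2∣m-k = ∣-lin₁ (m - + 2 * k) 2∣m-k (B-even-as-combination m k)

    2∣a₃ : + 2 ∣ℤ a₃
    2∣a₃ = [ (λ 2∣k → ∣-lin₁ (- (k * g * (m * m * m) * b)) 2∣k (identity₁ k g m b))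
           , (λ 2∣m-k → ∣-lin₁ (- (k * k * g * (m * m * m))) (2∣b 2∣m-k) (identity₂ k g m b)) ]′
           2∣k∨2∣m-k
      where
      identity₁ : ∀ k g m b → - (k * k * g * (m * m * m) * b) ≡ - (k * g * (m * m * m) * b) * k
      identity₁ = solve-∀
      identity₂ : ∀ k g m b → - (k * k * g * (m * m * m) * b) ≡ - (k * k * g * (m * m * m)) * b
      identity₂ = solve-∀

    -- Exactly one of kg and mb is odd: for even k, b is m² modulo 2; for odd k, b is even through
    -- its factor m - k, while g is always m² modulo 2.
    2∤a₁ : ¬ + 2 ∣ℤ a₁
    2∤a₁ 2∣a₁ = [ k-even , m-k-even ]′ 2∣k∨2∣m-k
      where
      2∤m² : ¬ + 2 ∣ℤ m * m
      2∤m² 2∣m² = 2∤m (prime-square prime[2] m 2∣m²)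
      isolate-mb : ∀ k g m b → m * b ≡ - + 1 * (k * g - m * b) + g * k
      isolate-mb = solve-∀
      isolate-kg : ∀ k g m b → k * g ≡ + 1 * (k * g - m * b) + m * b
      isolate-kg = solve-∀
      sum : ∀ m k → m ≡ + 1 * (m - k) + + 1 * k
      sum = solve-∀
      k-even : ¬ + 2 ∣ℤ k
      k-even 2∣k = 2∤m² (∣-lin₂ (+ 1) (+ 3 * m - + 2 * k)
        (prime-cancel prime[2] m b 2∤m (∣-lin₂ (- + 1) g 2∣a₁ 2∣k (isolate-mb k g m b)))
        2∣k (m²-via-B-even m k))
      m-k-even : ¬ + 2 ∣ℤ m - k
      m-k-even 2∣m-k =
        [ (λ 2∣k → 2∤m (∣-lin₂ (+ 1) (+ 1) 2∣m-k 2∣k (sum m k)))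
        , (λ 2∣g → 2∤m² (∣-lin₂ (- + 1) (+ 3 * m * k - + 2 * k * k) 2∣g (divides (+ 1) refl)
            (m²-via-G-even m k))) ]′
        (prime-* prime[2] k g (∣-lin₂ (+ 1) m 2∣a₁ (2∣b 2∣m-k) (isolate-kg k g m b)))

    2∤c₄-even : ¬ + 2 ∣ℤ c₄ℤ (curve-even m k)
    2∤c₄-even 2∣c₄ =
      2∤a₁ (p∣a₁ prime[2] a₁ a₂ a₃ (∣m⇒∣m*n a₂ (divides (+ 2) refl)) 2∣a₃ 2∣c₄)

  -- Primes of bad reduction

  module _ (E : EllipticCurve) (m n : ℤ) (m⊥n : Coprime ∣ m ∣ ∣ n ∣)
           (model : IntegralModel E (curve m n))
           (model-even : ∀ k → n ≡ k * + 2 → IntegralModel E (curve-even m k)) where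

    p∣badDivisor⇒¬goodModel : ∀ {p} → Prime p → + p ∣ℤ badDivisor m n → ¬ GoodModel E p
    p∣badDivisor⇒¬goodModel {p} p-prime p∣D good-E = [ p∣nmb-case , p∣g-case ]′
      (prime-* p-prime (n * m * B m n) (G m n) p∣D)
      where
      b g a₃ : ℤ
      b = B m n
      g = G m n
      a₃ = - (n * n * g * (m * m * m) * b)
      identity₁ : ∀ n m b g →
        - (n * n * g * (m * m * m) * b) ≡ - (n * g * (m * m)) * (n * m * b)
      identity₁ = solve-∀
      identity₂ : ∀ n m b g → - (n * n * g * (m * m * m) * b) ≡ - (n * n * (m * m * m) * b) * g
      identity₂ = solve-∀
      p²∣c₄ : + p ∣ℤ a₃ → + p * + p ∣ℤ c₄ℤ (curve m n)
      p²∣c₄ p∣a₃ = goodModel⇒p²∣c₄ p-prime E good-E (curve m n) model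
        (∣-trans p∣a₃ (a₃∣Δ-tangentForm (n * g - m * b) (- (n * (m * m * m) * b)) a₃))
      p∣g-case : ¬ + p ∣ℤ g
      p∣g-case p∣g = p∣g⇒p²∤c₄ p-prime m n (coprime-∤ p-prime m n m⊥n) p∣g
        (p²∣c₄ (∣-lin₁ (- (n * n * (m * m * m) * b)) p∣g (identity₂ n m b g)))
      -- For p = 2 and n even, `curve m n` is not minimal at 2, so the assumed good reduction is
      -- refuted on `curve-even`. This supplies the hypothesis under which `curve m n` settles the
      -- divisors of nmb.
      even-case : + p ∣ℤ + 2 → ¬ + p ∣ℤ n
      even-case p∣2 p∣n with prime⇒irreducible prime[2] (∣⇒∣ᵤ p∣2)
      ... | inj₁ refl = ¬prime[1] p-prime
      ... | inj₂ refl with p∣n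
      ...   | divides k n≡k*2 = 2∤c₄-even m k 2∤m (∣-trans (divides (+ 2) refl)
        (goodModel⇒p²∣c₄ prime[2] E good-E (curve-even m k) (model-even k n≡k*2)
          (∣-trans (2∣a₃ m k 2∤m)
            (a₃∣Δ-tangentForm (k * G-even m k - m * B-even m k)
              (- (k * (m * m * m) * B-even m k))
              (- (k * k * G-even m k * (m * m * m) * B-even m k))))))
        where
        2∤m : ¬ + 2 ∣ℤ m
        2∤m 2∣m = coprime-∤ prime[2] m n m⊥n 2∣m p∣n
      p∣nmb-case : ¬ + p ∣ℤ n * m * b
      p∣nmb-case p∣nmb =
        p∣nmb⇒p∤c₄ p-prime m n (coprime-∤ p-prime m n m⊥n) even-case p∣nmb
          (∣-trans (divides (+ p) refl)
            (p²∣c₄ (∣-lin₁ (- (n * g * (m * m))) p∣nmb (identity₁ n m b g))))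

open IntegralModels

-- From a point of order 10 to Kubert's family

module PointsOfOrder10 where
  open import Data.Rational.Base using (_+_; _-_; _*_; -_; _÷_)
  open import Tactic.RingSolver using (solve-∀)

  -- Addition of a fixed point

  -- Slopes are characterised by products, which keeps division and its nonzero instance out of the
  -- ring identities.
  ÷-unique : ∀ m x d (d≢0 : d ≢ 0ℚ) → m * d ≡ x → (x ÷ d) {{≢-nonZero d≢0}} ≡ m
  ÷-unique m x d d≢0 md≡x = *-cancelʳ d d≢0 (trans (trans (ℚ.*-assoc x (1/ d) d)
    (trans (cong (x *_) (ℚ.*-inverseˡ d)) (ℚ.*-identityʳ x))) (sym md≡x))
    where
    instance
      d-nonZero : ℚ.NonZero d
      d-nonZero = ≢-nonZero d≢0

  module _ (E : EllipticCurve) where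
    open EllipticCurve E

    add-chord : ∀ m x₁ y₁ x₂ y₂ → x₂ - x₁ ≢ 0ℚ → m * (x₂ - x₁) ≡ y₂ - y₁ →
      add E (aff x₁ y₁) (aff x₂ y₂) ≡ thirdReflected E m x₁ y₁ x₂
    add-chord m x₁ y₁ x₂ y₂ Δx≢0 slope with x₂ - x₁ ℚ.≟ 0ℚ
    ... | yes Δx≡0 = contradiction Δx≡0 Δx≢0
    ... | no ≢0 =
      cong (λ m → thirdReflected E m x₁ y₁ x₂) (÷-unique m (y₂ - y₁) (x₂ - x₁) ≢0 slope)

    tangentNumerator : ℚ → ℚ → ℚ
    tangentNumerator x y = ι (+ 3) * x * x + ι (+ 2) * a₂ * x + a₄ - a₁ * y

    add-tangent : ∀ m x y → y + y + a₁ * x + a₃ ≢ 0ℚ →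
      m * (y + y + a₁ * x + a₃) ≡ tangentNumerator x y →
      add E (aff x y) (aff x y) ≡ thirdReflected E m x y x
    add-tangent m x y d≢0 slope with x - x ℚ.≟ 0ℚ
    ... | no x-x≢0 = contradiction (ℚ.+-inverseʳ x) x-x≢0
    ... | yes _ with y + y + a₁ * x + a₃ ℚ.≟ 0ℚ
    ...   | yes d≡0 = contradiction d≡0 d≢0
    ...   | no ≢0 = cong (λ m → thirdReflected E m x y x)
      (÷-unique m (tangentNumerator x y) (y + y + a₁ * x + a₃) ≢0 slope)

    add-opposite : ∀ x₁ y₁ x₂ y₂ → x₂ - x₁ ≡ 0ℚ → y₁ + y₂ + a₁ * x₁ + a₃ ≡ 0ℚ →
      add E (aff x₁ y₁) (aff x₂ y₂) ≡ 𝒪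
    add-opposite x₁ y₁ x₂ y₂ Δx≡0 d≡0 with x₂ - x₁ ℚ.≟ 0ℚ
    ... | no Δx≢0 = contradiction Δx≡0 Δx≢0
    ... | yes _ with y₁ + y₂ + a₁ * x₁ + a₃ ℚ.≟ 0ℚ
    ...   | yes _  = refl
    ...   | no d≢0 = contradiction d≡0 d≢0

    -- Coordinates (X , Y) centred at the point (x₀ , y₀), in which the tangent
    -- of slope s becomes Y = 0 and the curve Y² + A₁XY + A₃Y = X³ + A₂X².
    module Local (x₀ y₀ s : ℚ) where

      A₁ A₂ A₃ : ℚ
      A₁ = a₁ + (s + s)
      A₂ = a₂ - s * a₁ + (x₀ + x₀ + x₀) - s * s
      A₃ = a₃ + x₀ * a₁ + (y₀ + y₀)

      P : Point
      P = aff x₀ y₀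

      local : ℚ → ℚ → Point
      local X Y = aff (x₀ + X) (y₀ + (s * X + Y))

      next : ℚ → ℚ → ℚ
      next μ X = μ * μ + A₁ * μ - A₂ - X

      -- Besides P, the line of slope μ through P meets the curve in two points
      -- with abscissas X and next μ X, so that μ and an abscissa determine the
      -- sum of P and the first of them as the reflection of the second.
      after : ℚ → ℚ → Point
      after μ X = local X (- (μ + A₁) * X - A₃)

      thirdReflected-local : ∀ μ X →
        thirdReflected E (s + μ) x₀ y₀ (x₀ + X) ≡ after μ (next μ X)
      thirdReflected-local μ X = cong₂ aff x-eq y-eq
        where
        x₃ : ℚ
        x₃ = (s + μ) * (s + μ) + a₁ * (s + μ) - a₂ - x₀ - (x₀ + X)
        x-identity : ∀ a₁ a₂ x₀ s μ X →
          (s + μ) * (s + μ) + a₁ * (s + μ) - a₂ - x₀ - (x₀ + X) ≡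
          x₀ + (μ * μ + (a₁ + (s + s)) * μ - (a₂ - s * a₁ + (x₀ + x₀ + x₀) - s * s) - X)
        x-identity = solve-∀ ℚ-ring
        x-eq : x₃ ≡ x₀ + next μ X
        x-eq = x-identity a₁ a₂ x₀ s μ X
        y-identity : ∀ a₁ a₃ x₀ y₀ s μ X →
          - ((s + μ) * (x₀ + X - x₀) + y₀) - a₁ * (x₀ + X) - a₃ ≡
          y₀ + (s * X + (- (μ + (a₁ + (s + s))) * X - (a₃ + x₀ * a₁ + (y₀ + y₀))))
        y-identity = solve-∀ ℚ-ring
        y-eq : - ((s + μ) * (x₃ - x₀) + y₀) - a₁ * x₃ - a₃ ≡
          y₀ + (s * next μ X + (- (μ + A₁) * next μ X - A₃))
        y-eq = trans (cong (λ x → - ((s + μ) * (x - x₀) + y₀) - a₁ * x - a₃) x-eq)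
          (y-identity a₁ a₃ x₀ y₀ s μ (next μ X))

      add-local : ∀ μ X Y → X ≢ 0ℚ → μ * X ≡ Y → add E P (local X Y) ≡ after μ (next μ X)
      add-local μ X _ X≢0 refl = trans
        (add-chord (s + μ) x₀ y₀ (x₀ + X) (y₀ + (s * X + μ * X))
          (λ Δx≡0 → X≢0 (trans (sym (Δx x₀ X)) Δx≡0)) (slope x₀ y₀ s μ X))
        (thirdReflected-local μ X)
        where
        Δx : ∀ x₀ X → x₀ + X - x₀ ≡ X
        Δx = solve-∀ ℚ-ring
        slope : ∀ x₀ y₀ s μ X → (s + μ) * (x₀ + X - x₀) ≡ y₀ + (s * X + μ * X) - y₀
        slope = solve-∀ ℚ-ring

      add-local-𝒪 : ∀ μ → add E P (after μ 0ℚ) ≡ 𝒪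
      add-local-𝒪 μ = add-opposite x₀ y₀ (x₀ + 0ℚ) _ (Δx x₀) (d a₁ a₃ x₀ y₀ s μ)
        where
        Δx : ∀ x₀ → x₀ + 0ℚ - x₀ ≡ 0ℚ
        Δx = solve-∀ ℚ-ring
        d : ∀ a₁ a₃ x₀ y₀ s μ →
          y₀ + (y₀ + (s * 0ℚ + (- (μ + (a₁ + (s + s))) * 0ℚ - (a₃ + x₀ * a₁ + (y₀ + y₀)))))
            + a₁ * x₀ + a₃ ≡ 0ℚ
        d = solve-∀ ℚ-ring

      double : A₃ ≢ 0ℚ → s * A₃ ≡ tangentNumerator x₀ y₀ → add E P P ≡ after 0ℚ (next 0ℚ 0ℚ)
      double A₃≢0 slope = trans
        (add-tangent s x₀ y₀ (λ d≡0 → A₃≢0 (trans d≡A₃ d≡0)) (trans (cong (s *_) (sym d≡A₃)) slope))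
        (trans (cong₂ (λ m x → thirdReflected E m x₀ y₀ x) (sym (ℚ.+-identityʳ s)) (sym (ℚ.+-identityʳ x₀)))
          (thirdReflected-local 0ℚ 0ℚ))
        where
        identity : ∀ a₁ a₃ x y → a₃ + x * a₁ + (y + y) ≡ y + y + a₁ * x + a₃
        identity = solve-∀ ℚ-ring
        d≡A₃ : A₃ ≡ y₀ + y₀ + a₁ * x₀ + a₃
        d≡A₃ = identity a₁ a₃ x₀ y₀

      multiple-next : ∀ k μ μ′ X → multiple E k P ≡ after μ X → X ≢ 0ℚ →
        μ′ * X ≡ - (μ + A₁) * X - A₃ → multiple E (suc k) P ≡ after μ′ (next μ′ X)
      multiple-next k μ μ′ X kP X≢0 slope =
        trans (cong (add E P) kP) (add-local μ′ X (- (μ + A₁) * X - A₃) X≢0 slope)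

      multiple-𝒪 : ∀ k μ X → multiple E k P ≡ after μ X → X ≡ 0ℚ → multiple E (suc k) P ≡ 𝒪
      multiple-𝒪 k μ X kP refl = trans (cong (add E P) kP) (add-local-𝒪 μ)

      multiple-𝒪⁻¹ : ∀ k μ X → multiple E k P ≡ after μ X → multiple E (suc k) P ≡ 𝒪 → X ≡ 0ℚ
      multiple-𝒪⁻¹ k μ X kP 1+kP with X ℚ.≟ 0ℚ
      ... | yes X≡0 = X≡0
      ... | no X≢0 with divide (- (μ + A₁) * X - A₃) X≢0
      ...   | μ′ , slope = contradiction (trans (sym (multiple-next k μ μ′ X kP X≢0 slope)) 1+kP) λ ()

  module Recurrence (A₁ A₂ A₃ : ℚ) where

    next : ℚ → ℚ → ℚ
    next μ X = μ * μ + A₁ * μ - A₂ - X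

    next-involutive : ∀ μ X → next μ (next μ X) ≡ X
    next-involutive = identity A₁ A₂
      where
      identity : ∀ A₁ A₂ μ X → μ * μ + A₁ * μ - A₂ - (μ * μ + A₁ * μ - A₂ - X) ≡ X
      identity = solve-∀ ℚ-ring

    Slope : ℚ → ℚ → ℚ → Set
    Slope μ μ′ X = μ′ * X ≡ - (μ + A₁) * X - A₃

    slope : ∀ μ {X} → X ≢ 0ℚ → ∃[ μ′ ] Slope μ μ′ X
    slope μ {X} X≢0 = divide (- (μ + A₁) * X - A₃) X≢0

    -- Vieta's formulas: besides X = 0, the line Y = μX meets the curve where X² - (μ² + A₁μ - A₂)X
    -- - A₃μ = 0. `next` encodes the sum of the roots, and this is their product; carried along the
    -- sequence, it replaces the equation of the curve.
    invariant : ∀ μ μ′ X → Slope μ μ′ (next μ X) → X * next μ X ≡ - A₃ * μ →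
      next μ X * next μ′ (next μ X) ≡ - A₃ * μ′
    invariant μ μ′ X slope-X′ XX′ = begin
      X′ * next μ′ X′
        ≡⟨ expand A₁ A₂ A₃ μ μ′ X ⟩
      X * X′ + (μ′ - μ) * (μ′ * X′ - (- (μ + A₁) * X′ - A₃) - A₃)
        ≡⟨ cong₂ (λ y z → y + (μ′ - μ) * (z - (- (μ + A₁) * X′ - A₃) - A₃)) XX′ slope-X′ ⟩
      - A₃ * μ + (μ′ - μ) * (- (μ + A₁) * X′ - A₃ - (- (μ + A₁) * X′ - A₃) - A₃)
        ≡⟨ collapse A₃ μ μ′ (- (μ + A₁) * X′ - A₃) ⟩
      - A₃ * μ′                                     ∎
      where
      open ≡-Reasoning
      X′ : ℚ
      X′ = next μ X
      expand : ∀ A₁ A₂ A₃ μ μ′ X → let X′ = μ * μ + A₁ * μ - A₂ - X in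
        X′ * (μ′ * μ′ + A₁ * μ′ - A₂ - X′) ≡
        X * X′ + (μ′ - μ) * (μ′ * X′ - (- (μ + A₁) * X′ - A₃) - A₃)
      expand = solve-∀ ℚ-ring
      collapse : ∀ A₃ μ μ′ z → - A₃ * μ + (μ′ - μ) * (z - z - A₃) ≡ - A₃ * μ′
      collapse = solve-∀ ℚ-ring

    -- Read backwards, the sequence consists of the multiples of -P, which
    -- satisfy the same recurrence.
    reverse : ∀ μ μ′ X ν ν′ Y → X ≢ 0ℚ → Slope μ μ′ X → Slope ν ν′ (next ν Y) →
      next ν Y ≡ X → ν′ ≡ μ → ν ≡ μ′ × Y ≡ next μ′ X
    reverse μ μ′ X ν ν′ Y X≢0 slope-X slope-Y refl refl = ν≡μ′ , (begin
      Y               ≡⟨ next-involutive ν Y ⟨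
      next ν X        ≡⟨ cong (λ ν → next ν X) ν≡μ′ ⟩
      next μ′ X       ∎)
      where
      open ≡-Reasoning
      expand₁ : ∀ A₁ A₃ μ ν X → ν * X ≡ - (μ * X) - A₁ * X - A₃ + (μ * X - (- (ν + A₁) * X - A₃))
      expand₁ = solve-∀ ℚ-ring
      expand₂ : ∀ A₁ A₃ μ X z → - (μ * X) - A₁ * X - A₃ + (z - z) ≡ - (μ + A₁) * X - A₃
      expand₂ = solve-∀ ℚ-ring
      ν≡μ′ : ν ≡ μ′
      ν≡μ′ = *-cancelʳ X X≢0 (begin
        ν * X      ≡⟨ expand₁ A₁ A₃ μ ν X ⟩
        - (μ * X) - A₁ * X - A₃ + (μ * X - (- (ν + A₁) * X - A₃))
                   ≡⟨ cong (λ z → - (μ * X) - A₁ * X - A₃ + (z - (- (ν + A₁) * X - A₃))) slope-Y ⟩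
        - (μ * X) - A₁ * X - A₃ + (- (ν + A₁) * X - A₃ - (- (ν + A₁) * X - A₃))
                   ≡⟨ expand₂ A₁ A₃ μ X (- (ν + A₁) * X - A₃) ⟩
        - (μ + A₁) * X - A₃     ≡⟨ slope-X ⟨
        μ′ * X                  ∎)

    -- X₂, …, X₅ are the abscissas of 2P, …, 5P; the slopes before and after 5P
    -- agree since 4P and 6P are opposite.
    record FifthMultiple2Torsion : Set where
      field
        μ₂ μ₃ μ₄ X₂ X₃ X₄ X₅ : ℚ
        X₂≡ : X₂ ≡ next 0ℚ 0ℚ
        X₃≡ : X₃ ≡ next μ₂ X₂
        X₄≡ : X₄ ≡ next μ₃ X₃
        X₅≡ : X₅ ≡ next μ₄ X₄
        X₂≢0     : X₂ ≢ 0ℚ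
        X₃≢0     : X₃ ≢ 0ℚ
        X₄≢0     : X₄ ≢ 0ℚ
        X₅≢0     : X₅ ≢ 0ℚ
        slope-X₂ : Slope 0ℚ μ₂ X₂
        slope-X₃ : Slope μ₂ μ₃ X₃
        slope-X₄ : Slope μ₃ μ₄ X₄
        slope-X₅ : Slope μ₄ μ₄ X₅

  module _ (E : EllipticCurve) (x₀ y₀ s : ℚ) where
    open EllipticCurve E
    open Local E x₀ y₀ s hiding (next)
    open Recurrence A₁ A₂ A₃

    -- Since 10P = 𝒪, the point 9P is -P and has abscissa 0. The product X₈X₉ = -A₃μ₈ then gives μ₈
    -- = 0, hence X₈ = X₂. These are the initial data of the sequence read backwards, and three
    -- reversals lead to μ₅ = μ₄.
    order-10⇒fifthMultiple2Torsion : HasOrder E P 10 → A₃ ≢ 0ℚ →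
      s * A₃ ≡ tangentNumerator E x₀ y₀ → FifthMultiple2Torsion
    order-10⇒fifthMultiple2Torsion (_ , 10P , kP≢𝒪) A₃≢0 tangent = record
      { μ₂ = μ₂ ; μ₃ = μ₃ ; μ₄ = μ₄
      ; X₂≡ = refl ; X₃≡ = refl ; X₄≡ = refl ; X₅≡ = refl
      ; X₂≢0 = X₂≢0 ; X₃≢0 = X₃≢0 ; X₄≢0 = X₄≢0 ; X₅≢0 = X₅≢0
      ; slope-X₂ = slope-X₂ ; slope-X₃ = slope-X₃ ; slope-X₄ = slope-X₄
      ; slope-X₅ = subst (λ μ → Slope μ₄ μ X₅) μ₅≡μ₄ slope-X₅
      }
      where
      -- The bound is 9 because abscissa 0 at kP makes the next multiple vanish, and k + 1 must stay
      -- below 10.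
      nonzero : ∀ k {k<9 : T (k ℕ.<ᵇ 9)} μ X → multiple E k P ≡ after μ X → X ≢ 0ℚ
      nonzero k {k<9} μ X kP X≡0 =
        kP≢𝒪 (suc k) z<s (s<s (ℕ.<ᵇ⇒< k 9 k<9)) (multiple-𝒪 k μ X kP X≡0)
      X₂ = next 0ℚ 0ℚ
      2P = double A₃≢0 tangent
      X₂≢0 = nonzero 2 0ℚ X₂ 2P
      μ₂ = proj₁ (slope 0ℚ X₂≢0)
      slope-X₂ = proj₂ (slope 0ℚ X₂≢0)
      X₃ = next μ₂ X₂
      3P = multiple-next 2 0ℚ μ₂ X₂ 2P X₂≢0 slope-X₂
      X₃≢0 = nonzero 3 μ₂ X₃ 3P
      μ₃ = proj₁ (slope μ₂ X₃≢0)
      slope-X₃ = proj₂ (slope μ₂ X₃≢0)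
      X₄ = next μ₃ X₃
      4P = multiple-next 3 μ₂ μ₃ X₃ 3P X₃≢0 slope-X₃
      X₄≢0 = nonzero 4 μ₃ X₄ 4P
      μ₄ = proj₁ (slope μ₃ X₄≢0)
      slope-X₄ = proj₂ (slope μ₃ X₄≢0)
      X₅ = next μ₄ X₄
      5P = multiple-next 4 μ₃ μ₄ X₄ 4P X₄≢0 slope-X₄
      X₅≢0 = nonzero 5 μ₄ X₅ 5P
      μ₅ = proj₁ (slope μ₄ X₅≢0)
      slope-X₅ = proj₂ (slope μ₄ X₅≢0)
      X₆ = next μ₅ X₅
      6P = multiple-next 5 μ₄ μ₅ X₅ 5P X₅≢0 slope-X₅
      X₆≢0 = nonzero 6 μ₅ X₆ 6P
      μ₆ = proj₁ (slope μ₅ X₆≢0)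
      slope-X₆ = proj₂ (slope μ₅ X₆≢0)
      X₇ = next μ₆ X₆
      7P = multiple-next 6 μ₅ μ₆ X₆ 6P X₆≢0 slope-X₆
      X₇≢0 = nonzero 7 μ₆ X₇ 7P
      μ₇ = proj₁ (slope μ₆ X₇≢0)
      slope-X₇ = proj₂ (slope μ₆ X₇≢0)
      X₈ = next μ₇ X₇
      8P = multiple-next 7 μ₆ μ₇ X₇ 7P X₇≢0 slope-X₇
      X₈≢0 = nonzero 8 μ₇ X₈ 8P
      μ₈ = proj₁ (slope μ₇ X₈≢0)
      slope-X₈ = proj₂ (slope μ₇ X₈≢0)
      X₉ = next μ₈ X₈
      9P = multiple-next 8 μ₇ μ₈ X₈ 8P X₈≢0 slope-X₈

      X₉≡0 : X₉ ≡ 0ℚ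
      X₉≡0 = multiple-𝒪⁻¹ 9 μ₈ X₉ 9P 10P

      μ₈≡0 : μ₈ ≡ 0ℚ
      μ₈≡0 = *-cancelˡ (- A₃) (λ -A₃≡0 → A₃≢0 (ℚ.neg-injective -A₃≡0)) (begin
        - A₃ * μ₈    ≡⟨ invariant-X₉ ⟨
        X₈ * X₉      ≡⟨ cong (X₈ *_) X₉≡0 ⟩
        X₈ * 0ℚ      ≡⟨ ℚ.*-zeroʳ X₈ ⟩
        0ℚ           ≡⟨ ℚ.*-zeroʳ (- A₃) ⟨
        - A₃ * 0ℚ    ∎)
        where
        open ≡-Reasoning
        invariant-X₉ : X₈ * X₉ ≡ - A₃ * μ₈
        invariant-X₉ =
          invariant μ₇ μ₈ X₇ slope-X₈ (invariant μ₆ μ₇ X₆ slope-X₇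
            (invariant μ₅ μ₆ X₅ slope-X₆ (invariant μ₄ μ₅ X₄ slope-X₅
            (invariant μ₃ μ₄ X₃ slope-X₄ (invariant μ₂ μ₃ X₂ slope-X₃
            -- The product relation starts at the tangent Y = 0, whose abscissas are 0 and X₂ and
            -- whose slope is 0.
            (invariant 0ℚ μ₂ 0ℚ slope-X₂ (trans (ℚ.*-zeroˡ X₂) (sym (ℚ.*-zeroʳ (- A₃))))))))))

      X₈≡X₂ : X₈ ≡ X₂
      X₈≡X₂ = begin
        X₈              ≡⟨ next-involutive μ₈ X₈ ⟨
        next μ₈ X₉      ≡⟨ cong₂ next μ₈≡0 X₉≡0 ⟩
        X₂              ∎
        where
        open ≡-Reasoning

      μ₅≡μ₄ : μ₅ ≡ μ₄
      μ₅≡μ₄ =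
        let μ₇≡μ₂ , X₇≡X₃ = reverse 0ℚ μ₂ X₂ μ₇ μ₈ X₇ X₂≢0 slope-X₂ slope-X₈ X₈≡X₂ μ₈≡0
            μ₆≡μ₃ , X₆≡X₄ = reverse μ₂ μ₃ X₃ μ₆ μ₇ X₆ X₃≢0 slope-X₃ slope-X₇ X₇≡X₃ μ₇≡μ₂
            μ₅≡μ₄ , _     = reverse μ₃ μ₄ X₄ μ₅ μ₆ X₅ X₄≢0 slope-X₄ slope-X₆ X₆≡X₄ μ₆≡μ₃
        in μ₅≡μ₄

  -- Lets the ring solver use a hypothesis: the conclusion follows once the two differences agree as
  -- polynomials.
  ≡-from-difference : ∀ {x y z w} → z ≡ w → x - y ≡ z - w → x ≡ y
  ≡-from-difference {x} {y} {z} refl x-y≡z-z = begin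
    x              ≡⟨ insert x y ⟩
    y + (x - y)    ≡⟨ cong (λ z → y + z) (trans x-y≡z-z (ℚ.+-inverseʳ z)) ⟩
    y + 0ℚ         ≡⟨ ℚ.+-identityʳ y ⟩
    y              ∎
    where
    open ≡-Reasoning
    insert : ∀ x y → x ≡ y + (x - y)
    insert = solve-∀ ℚ-ring

  *-≢0ˡ : ∀ {x y} → x * y ≢ 0ℚ → x ≢ 0ℚ
  *-≢0ˡ {y = y} xy≢0 refl = xy≢0 (ℚ.*-zeroˡ y)

  *-≢0ʳ : ∀ {x y} → x * y ≢ 0ℚ → y ≢ 0ℚ
  *-≢0ʳ {x} xy≢0 refl = xy≢0 (ℚ.*-zeroʳ x)

  -- β = e² - γ, so for d = e² / γ(e) one has d - 1 = β / γ.
  γ β : ℚ → ℚ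
  γ e = ι (+ 3) * e - e * e - 1ℚ
  β e = (e + e - 1ℚ) * (e - 1ℚ)

  -- Rescaled by A₃ / A₂ = κ γ(e), this is the Tate normal form with parameters
  -- b and c such that d = b / c and e = c / (d - 1) satisfy d γ(e) = e².
  record Kubert (A₁ A₂ A₃ : ℚ) : Set where
    field
      e κ : ℚ
      κ≢0 : κ ≢ 0ℚ
      e≢0 : e ≢ 0ℚ
      e≢1 : e - 1ℚ ≢ 0ℚ
      e≢½ : e + e - 1ℚ ≢ 0ℚ
      A₁≡ : A₁ ≡ κ * (γ e - e * β e)
      A₂≡ : A₂ ≡ κ * κ * - (e * e * e * β e)
      A₃≡ : A₃ ≡ κ * κ * κ * - (γ e * (e * e * e) * β e)

  module _ (A₁ A₂ A₃ μ₂ : ℚ) where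
    open Recurrence A₁ A₂ A₃

    third-abscissa : ∀ {X₂ X₃} → X₂ ≡ next 0ℚ 0ℚ → X₃ ≡ next μ₂ X₂ → X₃ ≡ μ₂ * (μ₂ + A₁)
    third-abscissa refl refl = identity A₁ A₂ μ₂
      where
      identity : ∀ A₁ A₂ μ₂ →
        μ₂ * μ₂ + A₁ * μ₂ - A₂ - (0ℚ * 0ℚ + A₁ * 0ℚ - A₂ - 0ℚ) ≡ μ₂ * (μ₂ + A₁)
      identity = solve-∀ ℚ-ring

    A₃-from-slope : ∀ {X₂} → X₂ ≡ next 0ℚ 0ℚ → Slope 0ℚ μ₂ X₂ → A₃ ≡ (μ₂ + A₁) * A₂
    A₃-from-slope refl slope-X₂ = ≡-from-difference slope-X₂ (identity A₁ A₂ A₃ μ₂)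
      where
      identity : ∀ A₁ A₂ A₃ μ₂ → let X₂ = 0ℚ * 0ℚ + A₁ * 0ℚ - A₂ - 0ℚ in
        A₃ - (μ₂ + A₁) * A₂ ≡ μ₂ * X₂ - (- (0ℚ + A₁) * X₂ - A₃)
      identity = solve-∀ ℚ-ring

  -- In units of u = A₃ / A₂, the slope μ₂ is the parameter c of the Tate normal form and v is d = b
  -- / c; accordingly e = μ₂ / (v - u) is c / (d - 1).
  module _ {A₁ A₂ A₃ : ℚ} (u v μ₂ : ℚ) (A₁≡ : A₁ ≡ u - μ₂) (A₂≡ : A₂ ≡ - (v * μ₂))
           (A₃≡ : A₃ ≡ u * A₂) where
    open Recurrence A₁ A₂ A₃

    third-slope : ∀ {μ₃ X₃} → X₃ ≡ μ₂ * u → X₃ ≢ 0ℚ → Slope μ₂ μ₃ X₃ → μ₃ ≡ v - u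
    third-slope refl X₃≢0 slope-X₃ =
      *-cancelʳ (μ₂ * u) X₃≢0 (trans slope-X₃ (reduce A₁≡ A₂≡ A₃≡))
      where
      identity : ∀ u v μ₂ →
        - (μ₂ + (u - μ₂)) * (μ₂ * u) - u * - (v * μ₂) ≡ (v - u) * (μ₂ * u)
      identity = solve-∀ ℚ-ring
      reduce : ∀ {A₁ A₂ A₃} → A₁ ≡ u - μ₂ → A₂ ≡ - (v * μ₂) → A₃ ≡ u * A₂ →
        - (μ₂ + A₁) * (μ₂ * u) - A₃ ≡ (v - u) * (μ₂ * u)
      reduce refl refl refl = identity u v μ₂

    fourth-abscissa : ∀ {μ₃ X₃ X₄} → X₃ ≡ μ₂ * u → μ₃ ≡ v - u → X₄ ≡ next μ₃ X₃ →
      X₄ ≡ (v - u) * v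
    fourth-abscissa refl refl X₄≡ = trans X₄≡ (reduce A₁≡ A₂≡)
      where
      identity : ∀ u v μ₂ →
        (v - u) * (v - u) + (u - μ₂) * (v - u) - - (v * μ₂) - μ₂ * u ≡ (v - u) * v
      identity = solve-∀ ℚ-ring
      reduce : ∀ {A₁ A₂} → A₁ ≡ u - μ₂ → A₂ ≡ - (v * μ₂) →
        (v - u) * (v - u) + A₁ * (v - u) - A₂ - μ₂ * u ≡ (v - u) * v
      reduce refl refl = identity u v μ₂

    module _ (e : ℚ) (μ₂≡ : e * (v - u) ≡ μ₂) where

      fourth-slope : ∀ {μ₃ μ₄ X₄} → μ₃ ≡ v - u → X₄ ≡ (v - u) * v → X₄ ≢ 0ℚ →
        Slope μ₃ μ₄ X₄ → μ₄ ≡ e * v - v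
      fourth-slope refl refl X₄≢0 slope-X₄ =
        *-cancelʳ ((v - u) * v) X₄≢0 (trans slope-X₄ (reduce μ₂≡ A₁≡ A₂≡ A₃≡))
        where
        identity : ∀ u v e →
          - (v - u + (u - e * (v - u))) * ((v - u) * v) - u * - (v * (e * (v - u)))
          ≡ (e * v - v) * ((v - u) * v)
        identity = solve-∀ ℚ-ring
        reduce : ∀ {A₁ A₂ A₃ μ₂} → e * (v - u) ≡ μ₂ → A₁ ≡ u - μ₂ → A₂ ≡ - (v * μ₂) → A₃ ≡ u * A₂ →
          - (v - u + A₁) * ((v - u) * v) - A₃ ≡ (e * v - v) * ((v - u) * v)
        reduce refl refl refl refl = identity u v e

      fifth-abscissa : ∀ {μ₄ X₄ X₅} → X₄ ≡ (v - u) * v → μ₄ ≡ e * v - v → X₅ ≡ next μ₄ X₄ →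
        X₅ ≡ v * (e - 1ℚ) * (e * u)
      fifth-abscissa refl refl X₅≡ = trans X₅≡ (reduce μ₂≡ A₁≡ A₂≡)
        where
        identity : ∀ u v e →
          (e * v - v) * (e * v - v) + (u - e * (v - u)) * (e * v - v) - - (v * (e * (v - u)))
            - (v - u) * v ≡ v * (e - 1ℚ) * (e * u)
        identity = solve-∀ ℚ-ring
        reduce : ∀ {A₁ A₂ μ₂} → e * (v - u) ≡ μ₂ → A₁ ≡ u - μ₂ → A₂ ≡ - (v * μ₂) →
          (e * v - v) * (e * v - v) + A₁ * (e * v - v) - A₂ - (v - u) * v ≡
          v * (e - 1ℚ) * (e * u)
        reduce refl refl refl = identity u v e

      -- 5P = -5P is the equation of X₁(10). After the nonzero factor uev is cancelled it is linear
      -- in v / u = d, which is why e parametrises its solutions.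
      fifth-slope : ∀ {μ₄ X₅} → μ₄ ≡ e * v - v → X₅ ≡ v * (e - 1ℚ) * (e * u) →
        u * e * v ≢ 0ℚ → Slope μ₄ μ₄ X₅ → v * γ e ≡ e * e * u
      fifth-slope refl refl uev≢0 slope-X₅ = *-cancelˡ (u * e * v) uev≢0
        (≡-from-difference (sym slope-X₅) (reduce μ₂≡ A₁≡ A₂≡ A₃≡))
        where
        identity : ∀ u v e →
          u * e * v * (v * (ι (+ 3) * e - e * e - 1ℚ)) - u * e * v * (e * e * u) ≡
          - (e * v - v + (u - e * (v - u))) * (v * (e - 1ℚ) * (e * u)) - u * - (v * (e * (v - u)))
          - (e * v - v) * (v * (e - 1ℚ) * (e * u))
        identity = solve-∀ ℚ-ring
        reduce : ∀ {A₁ A₂ A₃ μ₂} → e * (v - u) ≡ μ₂ → A₁ ≡ u - μ₂ → A₂ ≡ - (v * μ₂) → A₃ ≡ u * A₂ →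
          u * e * v * (v * γ e) - u * e * v * (e * e * u) ≡
          - (e * v - v + A₁) * (v * (e - 1ℚ) * (e * u)) - A₃
          - (e * v - v) * (v * (e - 1ℚ) * (e * u))
        reduce refl refl refl refl = identity u v e

    module _ (e κ : ℚ) (μ₂≡ : e * (v - u) ≡ μ₂) (u≡ : κ * γ e ≡ u) (v≡ : v ≡ κ * (e * e)) where

      v-u≡κβ : v - u ≡ κ * β e
      v-u≡κβ = trans (cong₂ _-_ v≡ (sym u≡)) (identity κ e)
        where
        identity : ∀ κ e → κ * (e * e) - κ * (ι (+ 3) * e - e * e - 1ℚ) ≡
          κ * ((e + e - 1ℚ) * (e - 1ℚ))
        identity = solve-∀ ℚ-ring

      μ₂≡eκβ : μ₂ ≡ e * (κ * β e)
      μ₂≡eκβ = trans (sym μ₂≡) (cong (e *_) v-u≡κβ)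

      A₁≡κ : A₁ ≡ κ * (γ e - e * β e)
      A₁≡κ = trans A₁≡ (trans (cong₂ _-_ (sym u≡) μ₂≡eκβ) (identity κ e (γ e) (β e)))
        where
        identity : ∀ κ e g b → κ * g - e * (κ * b) ≡ κ * (g - e * b)
        identity = solve-∀ ℚ-ring

      A₂≡κ² : A₂ ≡ κ * κ * - (e * e * e * β e)
      A₂≡κ² = trans A₂≡ (trans (cong₂ (λ v μ₂ → - (v * μ₂)) v≡ μ₂≡eκβ) (identity κ e (β e)))
        where
        identity : ∀ κ e b → - (κ * (e * e) * (e * (κ * b))) ≡ κ * κ * - (e * e * e * b)
        identity = solve-∀ ℚ-ring

      A₃≡κ³ : A₃ ≡ κ * κ * κ * - (γ e * (e * e * e) * β e)
      A₃≡κ³ = trans A₃≡ (trans (cong₂ _*_ (sym u≡) A₂≡κ²) (identity κ e (γ e) (β e)))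
        where
        identity : ∀ κ e g b →
          κ * g * (κ * κ * - (e * e * e * b)) ≡ κ * κ * κ * - (g * (e * e * e) * b)
        identity = solve-∀ ℚ-ring

  module _ {A₁ A₂ A₃ : ℚ} where
    open Recurrence A₁ A₂ A₃

    -- The excluded values of e come from nonzero abscissas: X₅ = v(e - 1)eu excludes 0 and 1, and
    -- X₄ = (v - u)v with v - u = κβ excludes 1/2. That γ(e) is nonzero follows from vγ(e) = e²u.
    fifthMultiple2Torsion⇒kubert : FifthMultiple2Torsion → Kubert A₁ A₂ A₃
    fifthMultiple2Torsion⇒kubert F = record
      { e = e ; κ = κ
      ; κ≢0 = *-≢0ˡ {κ} {γ e} (subst (_≢ 0ℚ) (sym κγ≡u) u≢0)
      ; e≢0 = e≢0
      ; e≢1 = *-≢0ʳ {v} {e - 1ℚ} (*-≢0ˡ {v * (e - 1ℚ)} {e * u} X₅≢0′)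
      ; e≢½ = *-≢0ˡ {e + e - 1ℚ} {e - 1ℚ} (*-≢0ʳ {κ} {β e}
          (subst (_≢ 0ℚ) (v-u≡κβ u v μ₂ A₁≡ A₂≡ A₃≡ e κ μ₂≡ κγ≡u v≡) v-u≢0))
      ; A₁≡ = A₁≡κ u v μ₂ A₁≡ A₂≡ A₃≡ e κ μ₂≡ κγ≡u v≡
      ; A₂≡ = A₂≡κ² u v μ₂ A₁≡ A₂≡ A₃≡ e κ μ₂≡ κγ≡u v≡
      ; A₃≡ = A₃≡κ³ u v μ₂ A₁≡ A₂≡ A₃≡ e κ μ₂≡ κγ≡u v≡
      }
      where
      open FifthMultiple2Torsion F
      u : ℚ
      u = μ₂ + A₁
      X₃≡′ : X₃ ≡ μ₂ * u
      X₃≡′ = third-abscissa A₁ A₂ A₃ μ₂ X₂≡ X₃≡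
      v,v* : ∃[ v ] v * μ₂ ≡ - A₂
      v,v* = divide (- A₂) (*-≢0ˡ {μ₂} {u} (subst (_≢ 0ℚ) X₃≡′ X₃≢0))
      v : ℚ
      v = proj₁ v,v*
      A₁≡ : A₁ ≡ u - μ₂
      A₁≡ = identity A₁ μ₂
        where
        identity : ∀ A₁ μ₂ → A₁ ≡ μ₂ + A₁ - μ₂
        identity = solve-∀ ℚ-ring
      A₂≡ : A₂ ≡ - (v * μ₂)
      A₂≡ = trans (sym (⁻¹-involutive A₂)) (cong -_ (sym (proj₂ v,v*)))
        where open import Algebra.Properties.Group ℚ.+-0-group using (⁻¹-involutive)
      A₃≡ : A₃ ≡ u * A₂
      A₃≡ = A₃-from-slope A₁ A₂ A₃ μ₂ X₂≡ slope-X₂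
      μ₃≡ : μ₃ ≡ v - u
      μ₃≡ = third-slope u v μ₂ A₁≡ A₂≡ A₃≡ X₃≡′ X₃≢0 slope-X₃
      X₄≡′ : X₄ ≡ (v - u) * v
      X₄≡′ = fourth-abscissa u v μ₂ A₁≡ A₂≡ A₃≡ X₃≡′ μ₃≡ X₄≡
      X₄≢0′ : (v - u) * v ≢ 0ℚ
      X₄≢0′ = subst (_≢ 0ℚ) X₄≡′ X₄≢0
      v-u≢0 : v - u ≢ 0ℚ
      v-u≢0 = *-≢0ˡ {v - u} {v} X₄≢0′
      e,e* : ∃[ e ] e * (v - u) ≡ μ₂
      e,e* = divide μ₂ v-u≢0
      e : ℚ
      e = proj₁ e,e*
      μ₂≡ : e * (v - u) ≡ μ₂
      μ₂≡ = proj₂ e,e*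
      μ₄≡ : μ₄ ≡ e * v - v
      μ₄≡ = fourth-slope u v μ₂ A₁≡ A₂≡ A₃≡ e μ₂≡ μ₃≡ X₄≡′ X₄≢0 slope-X₄
      X₅≡′ : X₅ ≡ v * (e - 1ℚ) * (e * u)
      X₅≡′ = fifth-abscissa u v μ₂ A₁≡ A₂≡ A₃≡ e μ₂≡ X₄≡′ μ₄≡ X₅≡
      X₅≢0′ : v * (e - 1ℚ) * (e * u) ≢ 0ℚ
      X₅≢0′ = subst (_≢ 0ℚ) X₅≡′ X₅≢0
      e≢0 : e ≢ 0ℚ
      e≢0 = *-≢0ˡ {e} {u} (*-≢0ʳ {v * (e - 1ℚ)} {e * u} X₅≢0′)
      u≢0 : u ≢ 0ℚ
      u≢0 = *-≢0ʳ {e} {u} (*-≢0ʳ {v * (e - 1ℚ)} {e * u} X₅≢0′)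
      vγ≡eeu : v * γ e ≡ e * e * u
      vγ≡eeu = fifth-slope u v μ₂ A₁≡ A₂≡ A₃≡ e μ₂≡ μ₄≡ X₅≡′
        (*-≢0 (*-≢0 u≢0 e≢0) (*-≢0ʳ {v - u} {v} X₄≢0′)) slope-X₅
      γ≢0 : γ e ≢ 0ℚ
      γ≢0 = *-≢0ʳ {v} {γ e} (subst (_≢ 0ℚ) (sym vγ≡eeu) (*-≢0 (*-≢0 e≢0 e≢0) u≢0))
      κ,κ* : ∃[ κ ] κ * γ e ≡ u
      κ,κ* = divide u γ≢0
      κ : ℚ
      κ = proj₁ κ,κ*
      κγ≡u : κ * γ e ≡ u
      κγ≡u = proj₂ κ,κ*
      v≡ : v ≡ κ * (e * e)
      v≡ = *-cancelʳ (γ e) γ≢0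
        (trans vγ≡eeu (trans (cong (e * e *_) (sym κγ≡u)) (identity e κ (γ e))))
        where
        identity : ∀ e κ g → e * e * (κ * g) ≡ κ * (e * e) * g
        identity = solve-∀ ℚ-ring

  module TangentModel (E : EllipticCurve) (x₀ y₀ s : ℚ)
      (on-curve : OnCurve E (aff x₀ y₀))
           (tangent : s * Local.A₃ E x₀ y₀ s ≡ tangentNumerator E x₀ y₀) where
    open Local E x₀ y₀ s using (A₁; A₂; A₃)
    open EllipticCurve E

    -- After (x₀ , y₀) is moved to the origin, a₄′ = 0 is the tangency of the line of slope s, and
    -- a₆′ = 0 says that the point lies on the curve.
    tangentModel : ∀ U b₁ b₂ b₃ → U ≢ 0ℚ →
      A₁ ≡ U * ι b₁ → A₂ ≡ U * U * ι b₂ → A₃ ≡ U * U * U * ι b₃ →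
      IntegralModel E (tangentForm b₁ b₂ b₃)
    tangentModel U b₁ b₂ b₃ U≢0 A₁≡ A₂≡ A₃≡ = record
      { u = U ; r = x₀ ; s = s ; t = y₀ ; u≢0 = U≢0
      ; eq₁ = sym A₁≡
      ; eq₂ = sym A₂≡
      ; eq₃ = sym A₃≡
      ; eq₄ = ≡-from-difference tangent (identity₄ U a₁ a₂ a₃ a₄ x₀ y₀ s)
      ; eq₆ = ≡-from-difference on-curve (identity₆ U a₁ a₂ a₃ a₄ a₆ x₀ y₀)
      }
      where
      identity₄ : ∀ U a₁ a₂ a₃ a₄ x y s →
        U * U * U * U * 0ℚ
          - (a₄ - s * a₃ + (x + x) * a₂ - (y + x * s) * a₁ + (x + x + x) * x - (s + s) * y)
        ≡ s * (a₃ + x * a₁ + (y + y)) - (ι (+ 3) * x * x + ι (+ 2) * a₂ * x + a₄ - a₁ * y)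
      identity₄ = solve-∀ ℚ-ring
      identity₆ : ∀ U a₁ a₂ a₃ a₄ a₆ x y →
        U * U * U * U * U * U * 0ℚ
          - (a₆ + x * a₄ + x * x * a₂ + x * x * x - y * a₃ - y * y - x * y * a₁)
        ≡ y * y + a₁ * x * y + a₃ * y - (x * x * x + a₂ * x * x + a₄ * x + a₆)
      identity₆ = solve-∀ ℚ-ring

  opaque
    unfolding G B G-even B-even

    ι-G : ∀ m n → ι (+ 3) * ι m * ι n - ι m * ι m - ι n * ι n ≈ι G m n
    ι-G m n = cast (+ 3) ⊠ cast m ⊠ cast n ⊟ cast m ⊠ cast m ⊟ cast n ⊠ cast n

    ι-B : ∀ m n → (ι (+ 2) * ι m - ι n) * (ι m - ι n) ≈ι B m n
    ι-B m n = (cast (+ 2) ⊠ cast m ⊟ cast n) ⊠ (cast m ⊟ cast n)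

    G-double : ∀ m k → G m (k ℤ.* + 2) ≡ G-even m k
    G-double = identity
      where
      identity : ∀ m k →
        + 3 ℤ.* m ℤ.* (k ℤ.* + 2) ℤ.- m ℤ.* m ℤ.- k ℤ.* + 2 ℤ.* (k ℤ.* + 2) ≡
        + 6 ℤ.* m ℤ.* k ℤ.- m ℤ.* m ℤ.- + 4 ℤ.* k ℤ.* k
      identity = ℤSolver.solve-∀

    B-double : ∀ m k → B m (k ℤ.* + 2) ≡ + 2 ℤ.* B-even m k
    B-double = identity
      where
      identity : ∀ m k →
        (+ 2 ℤ.* m ℤ.- k ℤ.* + 2) ℤ.* (m ℤ.- k ℤ.* + 2) ≡
        + 2 ℤ.* ((m ℤ.- k) ℤ.* (m ℤ.- + 2 ℤ.* k))
      identity = ℤSolver.solve-∀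

  module _ {A₁ A₂ A₃ : ℚ} (e κ : ℚ) (A₁≡ : A₁ ≡ κ * (γ e - e * β e))
           (A₂≡ : A₂ ≡ κ * κ * - (e * e * e * β e))
           (A₃≡ : A₃ ≡ κ * κ * κ * - (γ e * (e * e * e) * β e))
           (U : ℚ) (m n : ℤ) (κ≡ : U * (ι n * ι n * ι n) ≡ κ) (en≡m : e * ι n ≡ ι m) where
    private
      g b : ℤ
      g = G m n
      b = B m n
      gℚ bℚ : ℚ → ℚ → ℚ
      gℚ M N = ι (+ 3) * M * N - M * M - N * N
      bℚ M N = (ι (+ 2) * M - N) * (M - N)

    -- κ = Un³ because γ - eβ has degree 3 in e. The coefficients of A₂ and A₃ have degrees 5 and 7,
    -- so n⁶ and n⁹ leave the extra factors n and n² seen in `curve`.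
    A₁-homogeneous : A₁ ≡ U * ι (n ℤ.* g ℤ.- m ℤ.* b)
    A₁-homogeneous = begin
      A₁                          ≡⟨ A₁≡ ⟩
      κ * (γ e - e * β e)         ≡⟨ cong (_* (γ e - e * β e)) κ≡ ⟨
      U * (ι n * ι n * ι n) * (γ e - e * β e)  ≡⟨ identity U e (ι n) ⟩
      U * (ι n * gℚ (e * ι n) (ι n) - e * ι n * bℚ (e * ι n) (ι n))
        ≡⟨ cong (λ M → U * (ι n * gℚ M (ι n) - M * bℚ M (ι n))) en≡m ⟩
      U * (ι n * gℚ (ι m) (ι n) - ι m * bℚ (ι m) (ι n))
        ≡⟨ cong (U *_) (_≈ι_.equal (cast n ⊠ ι-G m n ⊟ cast m ⊠ ι-B m n)) ⟩
      U * ι (n ℤ.* g ℤ.- m ℤ.* b)   ∎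
      where
      open ≡-Reasoning
      identity : ∀ U e N →
        U * (N * N * N) * (ι (+ 3) * e - e * e - 1ℚ - e * ((e + e - 1ℚ) * (e - 1ℚ))) ≡
        U * (N * (ι (+ 3) * (e * N) * N - e * N * (e * N) - N * N)
          - e * N * ((ι (+ 2) * (e * N) - N) * (e * N - N)))
      identity = solve-∀ ℚ-ring

    A₂-homogeneous : A₂ ≡ U * U * ι (ℤ.- (n ℤ.* (m ℤ.* m ℤ.* m) ℤ.* b))
    A₂-homogeneous = begin
      A₂                              ≡⟨ A₂≡ ⟩
      κ * κ * - (e * e * e * β e)     ≡⟨ cong (λ κ → κ * κ * - (e * e * e * β e)) κ≡ ⟨
      _                               ≡⟨ identity U e (ι n) ⟩
      U * U * - (ι n * (e * ι n * (e * ι n) * (e * ι n)) * bℚ (e * ι n) (ι n))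
        ≡⟨ cong (λ M → U * U * - (ι n * (M * M * M) * bℚ M (ι n))) en≡m ⟩
      U * U * - (ι n * (ι m * ι m * ι m) * bℚ (ι m) (ι n))
        ≡⟨ cong (U * U *_) (_≈ι_.equal (⊟ (cast n ⊠ (cast m ⊠ cast m ⊠ cast m) ⊠ ι-B m n))) ⟩
      U * U * ι (ℤ.- (n ℤ.* (m ℤ.* m ℤ.* m) ℤ.* b))   ∎
      where
      open ≡-Reasoning
      identity : ∀ U e N →
        U * (N * N * N) * (U * (N * N * N)) * - (e * e * e * ((e + e - 1ℚ) * (e - 1ℚ))) ≡
        U * U * - (N * (e * N * (e * N) * (e * N)) * ((ι (+ 2) * (e * N) - N) * (e * N - N)))
      identity = solve-∀ ℚ-ring

    A₃-homogeneous : A₃ ≡ U * U * U * ι (ℤ.- (n ℤ.* n ℤ.* g ℤ.* (m ℤ.* m ℤ.* m) ℤ.* b))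
    A₃-homogeneous = begin
      A₃                              ≡⟨ A₃≡ ⟩
      κ * κ * κ * - (γ e * (e * e * e) * β e)
        ≡⟨ cong (λ κ → κ * κ * κ * - (γ e * (e * e * e) * β e)) κ≡ ⟨
      _                               ≡⟨ identity U e (ι n) ⟩
      U * U * U * - (ι n * ι n * gℚ (e * ι n) (ι n) * (e * ι n * (e * ι n) * (e * ι n))
                      * bℚ (e * ι n) (ι n))
        ≡⟨ cong (λ M → U * U * U * - (ι n * ι n * gℚ M (ι n) * (M * M * M) * bℚ M (ι n))) en≡m ⟩
      U * U * U * - (ι n * ι n * gℚ (ι m) (ι n) * (ι m * ι m * ι m) * bℚ (ι m) (ι n))
        ≡⟨ cong (U * U * U *_)
             (_≈ι_.equal (⊟ (cast n ⊠ cast n ⊠ ι-G m n ⊠ (cast m ⊠ cast m ⊠ cast m) ⊠ ι-B m n))) ⟩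
      U * U * U * ι (ℤ.- (n ℤ.* n ℤ.* g ℤ.* (m ℤ.* m ℤ.* m) ℤ.* b))   ∎
      where
      open ≡-Reasoning
      identity : ∀ U e N →
        U * (N * N * N) * (U * (N * N * N)) * (U * (N * N * N))
          * - ((ι (+ 3) * e - e * e - 1ℚ) * (e * e * e) * ((e + e - 1ℚ) * (e - 1ℚ))) ≡
        U * U * U * - (N * N * (ι (+ 3) * (e * N) * N - e * N * (e * N) - N * N)
          * (e * N * (e * N) * (e * N)) * ((ι (+ 2) * (e * N) - N) * (e * N - N)))
      identity = solve-∀ ℚ-ring

  -- The excluded values of e = m / n are the rational cusps of X₁(10).
  record NonCuspidal (m n : ℤ) : Set where
    field
      n>0  : ∃[ k ] n ≡ + suc k
      m≢0  : m ≢ 0ℤ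
      m≢n  : m ℤ.- n ≢ 0ℤ
      2m≢n : + 2 ℤ.* m ℤ.- n ≢ 0ℤ

  record Order10Curve (E : EllipticCurve) : Set where
    field
      m n    : ℤ
      m⊥n    : Coprime ∣ m ∣ ∣ n ∣
      noncuspidal : NonCuspidal m n
      model  : IntegralModel E (curve m n)
      model-even : ∀ k → n ≡ k ℤ.* + 2 → IntegralModel E (curve-even m k)

  a₁-double : ∀ {n} m k → n ≡ k ℤ.* + 2 →
    n ℤ.* G m n ℤ.- m ℤ.* B m n ≡ + 2 ℤ.* (k ℤ.* G-even m k ℤ.- m ℤ.* B-even m k)
  a₁-double m k refl = trans
    (cong₂ (λ g b → k ℤ.* + 2 ℤ.* g ℤ.- m ℤ.* b) (G-double m k) (B-double m k))
    (factor k m (G-even m k) (B-even m k))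
    where
    factor : ∀ k m g b → k ℤ.* + 2 ℤ.* g ℤ.- m ℤ.* (+ 2 ℤ.* b) ≡ + 2 ℤ.* (k ℤ.* g ℤ.- m ℤ.* b)
    factor = ℤSolver.solve-∀

  a₂-double : ∀ {n} m k → n ≡ k ℤ.* + 2 →
    ℤ.- (n ℤ.* (m ℤ.* m ℤ.* m) ℤ.* B m n) ≡
    + 4 ℤ.* ℤ.- (k ℤ.* (m ℤ.* m ℤ.* m) ℤ.* B-even m k)
  a₂-double m k refl = trans
    (cong (λ b → ℤ.- (k ℤ.* + 2 ℤ.* (m ℤ.* m ℤ.* m) ℤ.* b)) (B-double m k))
    (factor k m (B-even m k))
    where
    factor : ∀ k m b → ℤ.- (k ℤ.* + 2 ℤ.* (m ℤ.* m ℤ.* m) ℤ.* (+ 2 ℤ.* b)) ≡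
      + 4 ℤ.* ℤ.- (k ℤ.* (m ℤ.* m ℤ.* m) ℤ.* b)
    factor = ℤSolver.solve-∀

  a₃-double : ∀ {n} m k → n ≡ k ℤ.* + 2 →
    ℤ.- (n ℤ.* n ℤ.* G m n ℤ.* (m ℤ.* m ℤ.* m) ℤ.* B m n) ≡
    + 8 ℤ.* ℤ.- (k ℤ.* k ℤ.* G-even m k ℤ.* (m ℤ.* m ℤ.* m) ℤ.* B-even m k)
  a₃-double m k refl = trans
    (cong₂ (λ g b → ℤ.- (k ℤ.* + 2 ℤ.* (k ℤ.* + 2) ℤ.* g ℤ.* (m ℤ.* m ℤ.* m) ℤ.* b))
      (G-double m k) (B-double m k))
    (factor k m (G-even m k) (B-even m k))
    where
    factor : ∀ k m g b →
      ℤ.- (k ℤ.* + 2 ℤ.* (k ℤ.* + 2) ℤ.* g ℤ.* (m ℤ.* m ℤ.* m) ℤ.* (+ 2 ℤ.* b)) ≡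
      + 8 ℤ.* ℤ.- (k ℤ.* k ℤ.* g ℤ.* (m ℤ.* m ℤ.* m) ℤ.* b)
    factor = ℤSolver.solve-∀

  module _ (E : EllipticCurve) (x₀ y₀ s : ℚ)
           (on-curve : OnCurve E (aff x₀ y₀))
           (tangent : s * Local.A₃ E x₀ y₀ s ≡ tangentNumerator E x₀ y₀) where
    open Local E x₀ y₀ s using (A₁; A₂; A₃)
    open TangentModel E x₀ y₀ s on-curve tangent

    module _ (m n : ℤ) (U : ℚ) (U≢0 : U ≢ 0ℚ)
             (A₁≡ : A₁ ≡ U * ι (n ℤ.* G m n ℤ.- m ℤ.* B m n))
             (A₂≡ : A₂ ≡ U * U * ι (ℤ.- (n ℤ.* (m ℤ.* m ℤ.* m) ℤ.* B m n)))
             (A₃≡ : A₃ ≡ U * U * U * ι (ℤ.- (n ℤ.* n ℤ.* G m n ℤ.* (m ℤ.* m ℤ.* m) ℤ.* B m n)))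
             where

      curve-model : IntegralModel E (curve m n)
      curve-model = tangentModel U (n ℤ.* G m n ℤ.- m ℤ.* B m n)
        (ℤ.- (n ℤ.* (m ℤ.* m ℤ.* m) ℤ.* B m n))
        (ℤ.- (n ℤ.* n ℤ.* G m n ℤ.* (m ℤ.* m ℤ.* m) ℤ.* B m n)) U≢0 A₁≡ A₂≡ A₃≡

      curve-even-model : ∀ k → n ≡ k ℤ.* + 2 → IntegralModel E (curve-even m k)
      curve-even-model k n≡k*2 = tangentModel (U * ι (+ 2)) α₁ α₂ α₃ (*-≢0 U≢0 (λ ()))
        (scale U (+ 2) α₁ (a₁-double m k n≡k*2) A₁≡)
        (trans (scale (U * U) (+ 4) α₂ (a₂-double m k n≡k*2) A₂≡)
          (cong (_* ι α₂) (identity-4 U)))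
        (trans (scale (U * U * U) (+ 8) α₃ (a₃-double m k n≡k*2) A₃≡)
          (cong (_* ι α₃) (identity-8 U)))
        where
        α₁ α₂ α₃ : ℤ
        α₁ = k ℤ.* G-even m k ℤ.- m ℤ.* B-even m k
        α₂ = ℤ.- (k ℤ.* (m ℤ.* m ℤ.* m) ℤ.* B-even m k)
        α₃ = ℤ.- (k ℤ.* k ℤ.* G-even m k ℤ.* (m ℤ.* m ℤ.* m) ℤ.* B-even m k)
        scale : ∀ {A a} V c α → a ≡ c ℤ.* α → A ≡ V * ι a → A ≡ V * ι c * ι α
        scale V c α refl refl = trans (cong (V *_) (sym (ι-* c α))) (sym (ℚ.*-assoc V (ι c) (ι α)))
        identity-4 : ∀ U → U * U * ι (+ 4) ≡ U * ι (+ 2) * (U * ι (+ 2))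
        identity-4 = solve-∀ ℚ-ring
        identity-8 : ∀ U → U * U * U * ι (+ 8) ≡ U * ι (+ 2) * (U * ι (+ 2)) * (U * ι (+ 2))
        identity-8 = solve-∀ ℚ-ring

    kubert⇒order10Curve : Kubert A₁ A₂ A₃ → Order10Curve E
    kubert⇒order10Curve K = record
      { m = m ; n = n ; m⊥n = coprime e
      ; noncuspidal = record
        { n>0  = _ , refl
        ; m≢0  = λ m≡0 → e≢0 (vanishes (trans en≡m (cong ι m≡0)))
        ; m≢n  = λ m-n≡0 → e≢1 (vanishes (trans (identity₁ e (ι n)) (trans (cong (_- ι n) en≡m)
            (trans (_≈ι_.equal (cast m ⊟ cast n)) (cong ι m-n≡0)))))
        ; 2m≢n = λ 2m-n≡0 → e≢½ (vanishes (trans (identity₂ e (ι n))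
            (trans (cong (λ M → ι (+ 2) * M - ι n) en≡m)
            (trans (_≈ι_.equal (cast (+ 2) ⊠ cast m ⊟ cast n)) (cong ι 2m-n≡0)))))
        }
      ; model = curve-model m n U U≢0 A₁≡U A₂≡U A₃≡U
      ; model-even = curve-even-model m n U U≢0 A₁≡U A₂≡U A₃≡U
      }
      where
      open Kubert K
      m n : ℤ
      m = ↥ e
      n = ↧ e
      coprime : ∀ q → Coprime ∣ ↥ q ∣ ∣ ↧ q ∣
      coprime (mkℚ _ _ c) = ℕ.recompute c
      en≡m : e * ι n ≡ ι m
      en≡m = ↥↧ e
      n≢0 : ι n ≢ 0ℚ
      n≢0 ιn≡0 = contradiction (ι-injective {n} {0ℤ} ιn≡0) λ ()
      vanishes : ∀ {x} → x * ι n ≡ 0ℚ → x ≡ 0ℚ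
      vanishes xn≡0 = *-cancelʳ (ι n) n≢0 (trans xn≡0 (sym (ℚ.*-zeroˡ (ι n))))
      identity₁ : ∀ e N → (e - 1ℚ) * N ≡ e * N - N
      identity₁ = solve-∀ ℚ-ring
      identity₂ : ∀ e N → (e + e - 1ℚ) * N ≡ ι (+ 2) * (e * N) - N
      identity₂ = solve-∀ ℚ-ring
      U,U* : ∃[ U ] U * (ι n * ι n * ι n) ≡ κ
      U,U* = divide κ (*-≢0 (*-≢0 n≢0 n≢0) n≢0)
      U : ℚ
      U = proj₁ U,U*
      κ≡ : U * (ι n * ι n * ι n) ≡ κ
      κ≡ = proj₂ U,U*
      U≢0 : U ≢ 0ℚ
      U≢0 = *-≢0ˡ {U} (subst (_≢ 0ℚ) (sym κ≡) κ≢0)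
      A₁≡U : A₁ ≡ U * ι (n ℤ.* G m n ℤ.- m ℤ.* B m n)
      A₁≡U = A₁-homogeneous e κ A₁≡ A₂≡ A₃≡ U m n κ≡ en≡m
      A₂≡U : A₂ ≡ U * U * ι (ℤ.- (n ℤ.* (m ℤ.* m ℤ.* m) ℤ.* B m n))
      A₂≡U = A₂-homogeneous e κ A₁≡ A₂≡ A₃≡ U m n κ≡ en≡m
      A₃≡U : A₃ ≡ U * U * U * ι (ℤ.- (n ℤ.* n ℤ.* G m n ℤ.* (m ℤ.* m ℤ.* m) ℤ.* B m n))
      A₃≡U = A₃-homogeneous e κ A₁≡ A₂≡ A₃≡ U m n κ≡ en≡m

  order10⇒order10Curve : ∀ E P → OnCurve E P → HasOrder E P 10 → Order10Curve E
  order10⇒order10Curve E 𝒪 _ (_ , _ , kP≢𝒪) = contradiction refl (kP≢𝒪 1 z<s (s<s z<s))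
  order10⇒order10Curve E P@(aff x₀ y₀) on-curve order@(_ , _ , kP≢𝒪) =
    kubert⇒order10Curve E x₀ y₀ s on-curve tangent
      (fifthMultiple2Torsion⇒kubert
        (order-10⇒fifthMultiple2Torsion E x₀ y₀ s order A₃≢0 tangent))
    where
    open EllipticCurve E
    A₃ : ℚ
    A₃ = a₃ + x₀ * a₁ + (y₀ + y₀)
    identity : ∀ a₁ a₃ x y → y + y + a₁ * x + a₃ ≡ a₃ + x * a₁ + (y + y)
    identity = solve-∀ ℚ-ring
    A₃≢0 : A₃ ≢ 0ℚ
    A₃≢0 A₃≡0 = kP≢𝒪 2 z<s (s<s (s<s z<s))
      (add-opposite E x₀ y₀ x₀ y₀ (ℚ.+-inverseʳ x₀) (trans (identity a₁ a₃ x₀ y₀) A₃≡0))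
    s,s* : ∃[ s ] s * A₃ ≡ tangentNumerator E x₀ y₀
    s,s* = divide (tangentNumerator E x₀ y₀) A₃≢0
    s : ℚ
    s = proj₁ s,s*
    tangent : s * A₃ ≡ tangentNumerator E x₀ y₀
    tangent = proj₂ s,s*

open PointsOfOrder10

-- Curves whose only bad primes are two given ones

module BadPrimes where
  open import Data.Integer.Base using (_+_; _-_; _*_; -_)
  open import Data.Integer.Tactic.RingSolver using (solve-∀)

  -- Bad primes divide the conductor

  prime∣prime⇒≡ : ∀ {p q} → Prime p → Prime q → p ℕ.∣ q → p ≡ q
  prime∣prime⇒≡ p-prime q-prime p∣q with prime⇒irreducible q-prime p∣q
  ... | inj₁ refl = contradiction p-prime ¬prime[1]
  ... | inj₂ p≡q  = p≡q

  prime∣^⇒≡ : ∀ {p q} → Prime p → Prime q → ∀ k → p ℕ.∣ q ^ k → p ≡ q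
  prime∣^⇒≡ p-prime q-prime zero    p∣1 =
    contradiction (subst Prime (ℕ.∣1⇒≡1 p∣1) p-prime) ¬prime[1]
  prime∣^⇒≡ {q = q} p-prime q-prime (suc k) p∣q*q^k =
    [ prime∣prime⇒≡ p-prime q-prime , prime∣^⇒≡ p-prime q-prime k ]′
      (euclidsLemma q (q ^ k) p-prime p∣q*q^k)

  module _ (E : EllipticCurve) {p q : ℕ} (p-prime : Prime p) (q-prime : Prime q) (α β : ℕ)
           (conductor : IsConductor E (p ^ α ℕ.* q ^ β)) where

    ¬goodModel⇒p∨q : ∀ {ℓ} → Prime ℓ → ¬ GoodModel E ℓ → ℓ ≡ p ⊎ ℓ ≡ q
    ¬goodModel⇒p∨q {ℓ} ℓ-prime bad with conductor ℓ ℓ-prime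
    ... | zero  , exponent , _ = contradiction (conductorExponent-0⇒goodModel E ℓ exponent) bad
    ... | suc f , _ , (ℓ^f∣N , _) =
      [ inj₁ ∘ prime∣^⇒≡ ℓ-prime p-prime α , inj₂ ∘ prime∣^⇒≡ ℓ-prime q-prime β ]′
        (euclidsLemma (p ^ α) (q ^ β) ℓ-prime (ℕ.∣-trans (ℕ.m∣m*n (ℓ ^ f)) ℓ^f∣N))

  -- The Diophantine problem

  primeDivisor : ∀ n → n ≢ 1 → ∃[ p ] Prime p × p ℕ.∣ n
  primeDivisor zero      _   = 2 , prime[2] , 2 ℕ.∣0
  primeDivisor n@(suc _) n≢1 with factorise n
  ... | record { factors = []    ; isFactorisation = n≡1 } = contradiction n≡1 n≢1
  ... | record { factors = p ∷ ps ; isFactorisation = n≡ ; factorsPrime = p-prime All.∷ _ } =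
    p , p-prime , subst (p ℕ.∣_) (sym n≡) (ℕ.m∣m*n (product ps))

  ∣i∣≡1⇒i≡±1 : ∀ i → ∣ i ∣ ≡ 1 → i ≡ + 1 ⊎ i ≡ - + 1
  ∣i∣≡1⇒i≡±1 (+ 1)     refl = inj₁ refl
  ∣i∣≡1⇒i≡±1 -[1+ 0 ] refl = inj₂ refl

  -- If n = 1, m = ± 1 or m - n = ± 1, then `G m n` is, up to sign and a change of variable t, this
  -- polynomial.
  quadratic : ℤ → ℤ
  quadratic t = t * t - + 3 * t + + 1

  -- The first pair solves `quadratic t ≡ + 1`, the second `quadratic t ≡ - + 1`.
  Root : ℤ → Set
  Root t = (t ≡ + 0 ⊎ t ≡ + 3) ⊎ (t ≡ + 1 ⊎ t ≡ + 2)

  quadratic-unit : ∀ t → ∣ quadratic t ∣ ≡ 1 → Root t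
  quadratic-unit t unit with ∣i∣≡1⇒i≡±1 (quadratic t) unit
  ... | inj₁ ≡1 = inj₁ (split (ℤ.i*j≡0⇒i≡0∨j≡0 t (trans (identity t) (cong (_- + 1) ≡1))))
    where
    identity : ∀ t → t * (t - + 3) ≡ t * t - + 3 * t + + 1 - + 1
    identity = solve-∀
    split : t ≡ 0ℤ ⊎ t - + 3 ≡ 0ℤ → t ≡ + 0 ⊎ t ≡ + 3
    split (inj₁ t≡0)   = inj₁ t≡0
    split (inj₂ t-3≡0) = inj₂ (ℤ.i-j≡0⇒i≡j t (+ 3) t-3≡0)
  ... | inj₂ ≡-1 = inj₂ (split (ℤ.i*j≡0⇒i≡0∨j≡0 (t - + 1) (trans (identity t) (cong (_+ + 1) ≡-1))))
    where
    identity : ∀ t → (t - + 1) * (t - + 2) ≡ t * t - + 3 * t + + 1 + + 1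
    identity = solve-∀
    split : t - + 1 ≡ 0ℤ ⊎ t - + 2 ≡ 0ℤ → t ≡ + 1 ⊎ t ≡ + 2
    split (inj₁ t-1≡0) = inj₁ (ℤ.i-j≡0⇒i≡j t (+ 1) t-1≡0)
    split (inj₂ t-2≡0) = inj₂ (ℤ.i-j≡0⇒i≡j t (+ 2) t-2≡0)

  opaque
    unfolding G B

    G-n≡1 : ∀ m → G m (+ 1) ≡ - quadratic m
    G-n≡1 = identity
      where
      identity : ∀ m → + 3 * m * + 1 - m * m - + 1 * + 1 ≡ - (m * m - + 3 * m + + 1)
      identity = solve-∀

    G-m≡1 : ∀ n → G (+ 1) n ≡ - quadratic n
    G-m≡1 = identity
      where
      identity : ∀ n → + 3 * + 1 * n - + 1 * + 1 - n * n ≡ - (n * n - + 3 * n + + 1)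
      identity = solve-∀

    G-m≡-1 : ∀ n → G (- + 1) n ≡ - quadratic (- n)
    G-m≡-1 = identity
      where
      identity : ∀ n → + 3 * - + 1 * n - - + 1 * - + 1 - n * n ≡ - (- n * - n - + 3 * - n + + 1)
      identity = solve-∀

    G-m-n≡1 : ∀ n → G (+ 1 + n) n ≡ quadratic (n + + 2)
    G-m-n≡1 = identity
      where
      identity : ∀ n → + 3 * (+ 1 + n) * n - (+ 1 + n) * (+ 1 + n) - n * n ≡
        (n + + 2) * (n + + 2) - + 3 * (n + + 2) + + 1
      identity = solve-∀

    G-m-n≡-1 : ∀ n → G (- + 1 + n) n ≡ quadratic (n + + 1)
    G-m-n≡-1 = identity
      where
      identity : ∀ n → + 3 * (- + 1 + n) * n - (- + 1 + n) * (- + 1 + n) - n * n ≡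
        (n + + 1) * (n + + 1) - + 3 * (n + + 1) + + 1
      identity = solve-∀

    m-n∣B : ∀ {k} m n → k ∣ℤ m - n → k ∣ℤ B m n
    m-n∣B m n k∣m-n = ∣n⇒∣m*n (+ 2 * m - n) k∣m-n

  data SmallCurve : ℤ → ℤ → Set where
    [2,1]  : SmallCurve (+ 2) (+ 1)
    [3,1]  : SmallCurve (+ 3) (+ 1)
    [1,3]  : SmallCurve (+ 1) (+ 3)
    [-1,1] : SmallCurve (- + 1) (+ 1)

  Unit : ℤ → Set
  Unit x = ∣ x ∣ ≡ 1

  unit-neg : ∀ {x y} → x ≡ - y → Unit x → Unit y
  unit-neg {y = y} refl unit = trans (sym (ℤ.∣-i∣≡∣i∣ y)) unit

  unit-subst : ∀ {x y} → x ≡ y → Unit x → Unit y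
  unit-subst refl unit = unit

  isolate : ∀ x a {b} → x + a ≡ b → x ≡ b - a
  isolate x a refl = identity x a
    where
    identity : ∀ x a → x ≡ x + a - a
    identity = solve-∀

  isolate-difference : ∀ m n {d} → m - n ≡ d → m ≡ d + n
  isolate-difference m n refl = identity m n
    where
    identity : ∀ m n → m ≡ m - n + n
    identity = solve-∀

  open NonCuspidal

  positive-unit : ∀ {n} → ∃[ k ] n ≡ + suc k → Unit n → n ≡ + 1
  positive-unit (k , refl) unit = cong +_ unit

  -- This and the next five lemmas treat the pairs of units among n, m, m - n and `G m n`. Solutions
  -- outside `SmallCurve` are cusps or have n ≤ 0.
  n∧m : ∀ {m n} → NonCuspidal m n → Unit n → Unit m → SmallCurve m n
  n∧m {m} nc unit-n unit-m with positive-unit (nc .n>0) unit-n | ∣i∣≡1⇒i≡±1 m unit-m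
  ... | refl | inj₁ refl = contradiction refl (nc .m≢n)
  ... | refl | inj₂ refl = [-1,1]

  n∧m-n : ∀ {m n} → NonCuspidal m n → Unit n → Unit (m - n) → SmallCurve m n
  n∧m-n {m} nc unit-n unit-m-n with positive-unit (nc .n>0) unit-n
  ... | refl with ∣i∣≡1⇒i≡±1 (m - + 1) unit-m-n
  ...   | inj₁ m-1≡1 = subst (λ m → SmallCurve m (+ 1)) (sym (isolate-difference m (+ 1) m-1≡1)) [2,1]
  ...   | inj₂ m-1≡-1 = contradiction (isolate-difference m (+ 1) m-1≡-1) (nc .m≢0)

  n∧G : ∀ {m n} → NonCuspidal m n → Unit n → Unit (G m n) → SmallCurve m n
  n∧G {m} nc unit-n unit-G with positive-unit (nc .n>0) unit-n
  ... | refl with quadratic-unit m (unit-neg (G-n≡1 m) unit-G)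
  ...   | inj₁ (inj₁ m≡0)  = contradiction m≡0 (nc .m≢0)
  ...   | inj₁ (inj₂ refl) = [3,1]
  ...   | inj₂ (inj₁ refl) = contradiction refl (nc .m≢n)
  ...   | inj₂ (inj₂ refl) = [2,1]

  m∧G : ∀ {m n} → NonCuspidal m n → Unit m → Unit (G m n) → SmallCurve m n
  m∧G {m} {n} nc unit-m unit-G with ∣i∣≡1⇒i≡±1 m unit-m
  ... | inj₁ refl = positive nc (quadratic-unit n (unit-neg (G-m≡1 n) unit-G))
    where
    positive : ∀ {n} → NonCuspidal (+ 1) n → Root n → SmallCurve (+ 1) n
    positive nc (inj₁ (inj₁ refl)) = contradiction (proj₂ (nc .n>0)) λ ()
    positive nc (inj₁ (inj₂ refl)) = [1,3]
    positive nc (inj₂ (inj₁ refl)) = contradiction refl (nc .m≢n)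
    positive nc (inj₂ (inj₂ refl)) = contradiction refl (nc .2m≢n)
  ... | inj₂ refl =
    contradiction (quadratic-unit (- n) (unit-neg (G-m≡-1 n) unit-G)) (negative (nc .n>0))
    where
    negative : ∀ {n} → ∃[ k ] n ≡ + suc k → ¬ Root (- n)
    negative (_ , refl) (inj₁ (inj₁ ()))
    negative (_ , refl) (inj₁ (inj₂ ()))
    negative (_ , refl) (inj₂ (inj₁ ()))
    negative (_ , refl) (inj₂ (inj₂ ()))

  -- No curve arises here: n is 0 or -2, or (m , n) = (1 , 2) is the cusp e = 1/2.
  m∧m-n : ∀ {m n} → NonCuspidal m n → Unit m → Unit (m - n) → SmallCurve m n
  m∧m-n {m} {n} nc unit-m unit-m-n =
    cases nc (∣i∣≡1⇒i≡±1 m unit-m) (∣i∣≡1⇒i≡±1 (m - n) unit-m-n) (identity m n)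
    where
    identity : ∀ m n → n ≡ m - (m - n)
    identity = solve-∀
    cases : ∀ {m n d} → NonCuspidal m n → m ≡ + 1 ⊎ m ≡ - + 1 → d ≡ + 1 ⊎ d ≡ - + 1 →
      n ≡ m - d → SmallCurve m n
    cases nc (inj₁ refl) (inj₁ refl) refl = contradiction (proj₂ (nc .n>0)) λ ()
    cases nc (inj₁ refl) (inj₂ refl) refl = contradiction refl (nc .2m≢n)
    cases nc (inj₂ refl) (inj₁ refl) refl = contradiction (proj₂ (nc .n>0)) λ ()
    cases nc (inj₂ refl) (inj₂ refl) refl = contradiction (proj₂ (nc .n>0)) λ ()

  m-n∧G : ∀ {m n} → NonCuspidal m n → Unit (m - n) → Unit (G m n) → SmallCurve m n
  m-n∧G {m} {n} nc unit-m-n unit-G with ∣i∣≡1⇒i≡±1 (m - n) unit-m-n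
  ... | inj₁ m-n≡1 = above nc m≡
      (quadratic-unit (n + + 2) (unit-subst (trans (cong (λ m → G m n) m≡) (G-m-n≡1 n)) unit-G))
    where
    m≡ : m ≡ + 1 + n
    m≡ = isolate-difference m n m-n≡1
    above : ∀ {m n} → NonCuspidal m n → m ≡ + 1 + n → Root (n + + 2) → SmallCurve m n
    above {n = n} nc m≡ (inj₁ (inj₁ n+2≡0)) with isolate n (+ 2) n+2≡0
    ... | refl = contradiction (proj₂ (nc .n>0)) λ ()
    above {n = n} nc m≡ (inj₁ (inj₂ n+2≡3)) with isolate n (+ 2) n+2≡3 | m≡
    ... | refl | refl = [2,1]
    above {n = n} nc m≡ (inj₂ (inj₁ n+2≡1)) with isolate n (+ 2) n+2≡1
    ... | refl = contradiction (proj₂ (nc .n>0)) λ ()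
    above {n = n} nc m≡ (inj₂ (inj₂ n+2≡2)) with isolate n (+ 2) n+2≡2
    ... | refl = contradiction (proj₂ (nc .n>0)) λ ()
  ... | inj₂ m-n≡-1 = below nc m≡
      (quadratic-unit (n + + 1) (unit-subst (trans (cong (λ m → G m n) m≡) (G-m-n≡-1 n)) unit-G))
    where
    m≡ : m ≡ - + 1 + n
    m≡ = isolate-difference m n m-n≡-1
    below : ∀ {m n} → NonCuspidal m n → m ≡ - + 1 + n → Root (n + + 1) → SmallCurve m n
    below {n = n} nc m≡ (inj₁ (inj₁ n+1≡0)) with isolate n (+ 1) n+1≡0
    ... | refl = contradiction (proj₂ (nc .n>0)) λ ()
    below {n = n} nc m≡ (inj₁ (inj₂ n+1≡3)) with isolate n (+ 1) n+1≡3 | m≡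
    ... | refl | refl = contradiction refl (nc .2m≢n)
    below {n = n} nc m≡ (inj₂ (inj₁ n+1≡1)) with isolate n (+ 1) n+1≡1
    ... | refl = contradiction (proj₂ (nc .n>0)) λ ()
    below {n = n} nc m≡ (inj₂ (inj₂ n+1≡2)) with isolate n (+ 1) n+1≡2
    ... | refl = contradiction m≡ (nc .m≢0)

  module _ (D : ℤ) (r : ℕ) (only : ∀ {ℓ} → Prime ℓ → + ℓ ∣ℤ D → ℓ ≡ 2 ⊎ ℓ ≡ r) where

    odd-primeDivisor : ∀ {x} → x ∣ℤ D → ¬ + 2 ∣ℤ x → ¬ Unit x → ∃[ ℓ ] Prime ℓ × + ℓ ∣ℤ x × ℓ ≡ r
    odd-primeDivisor {x} x∣D 2∤x x≢1 with primeDivisor ∣ x ∣ x≢1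
    ... | ℓ , ℓ-prime , ℓ∣x with only ℓ-prime (∣-trans (∣ᵤ⇒∣ ℓ∣x) x∣D)
    ...   | inj₁ refl = contradiction (∣ᵤ⇒∣ ℓ∣x) 2∤x
    ...   | inj₂ ℓ≡r  = ℓ , ℓ-prime , ∣ᵤ⇒∣ ℓ∣x , ℓ≡r

    -- An odd divisor of `D` that is not a unit must be divisible by `r`, which cannot happen for
    -- two coprime ones.
    one-unit : ∀ {x y} → x ∣ℤ D → y ∣ℤ D → ¬ + 2 ∣ℤ x → ¬ + 2 ∣ℤ y →
      (∀ {ℓ} → Prime ℓ → + ℓ ∣ℤ x → ¬ + ℓ ∣ℤ y) → Unit x ⊎ Unit y
    one-unit {x} {y} x∣D y∣D 2∤x 2∤y x⊥y with ∣ x ∣ ℕ.≟ 1 | ∣ y ∣ ℕ.≟ 1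
    ... | yes unit-x | _ = inj₁ unit-x
    ... | no _ | yes unit-y = inj₂ unit-y
    ... | no x≢1 | no y≢1
      with odd-primeDivisor x∣D 2∤x x≢1 | odd-primeDivisor y∣D 2∤y y≢1
    ...   | ℓ , ℓ-prime , ℓ∣x , refl | _ , _ , ℓ∣y , refl = contradiction ℓ∣y (x⊥y ℓ-prime ℓ∣x)

    two-units : ∀ {x y z} → x ∣ℤ D → y ∣ℤ D → z ∣ℤ D → ¬ + 2 ∣ℤ x → ¬ + 2 ∣ℤ y → ¬ + 2 ∣ℤ z →
      (∀ {ℓ} → Prime ℓ → + ℓ ∣ℤ x → ¬ + ℓ ∣ℤ y) →
      (∀ {ℓ} → Prime ℓ → + ℓ ∣ℤ z → ¬ + ℓ ∣ℤ x) →
      (∀ {ℓ} → Prime ℓ → + ℓ ∣ℤ z → ¬ + ℓ ∣ℤ y) →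
      Unit x × Unit y ⊎ Unit x × Unit z ⊎ Unit y × Unit z
    two-units x∣D y∣D z∣D 2∤x 2∤y 2∤z x⊥y z⊥x z⊥y
      with one-unit x∣D y∣D 2∤x 2∤y x⊥y
         | one-unit z∣D x∣D 2∤z 2∤x z⊥x
         | one-unit z∣D y∣D 2∤z 2∤y z⊥y
    ... | inj₁ ux | _       | inj₁ uz = inj₂ (inj₁ (ux , uz))
    ... | inj₁ ux | _       | inj₂ uy = inj₁ (ux , uy)
    ... | inj₂ uy | inj₁ uz | _       = inj₂ (inj₂ (uy , uz))
    ... | inj₂ uy | inj₂ ux | _       = inj₁ (ux , uy)

  module _ (m n : ℤ) (m⊥n : Coprime ∣ m ∣ ∣ n ∣) where
    private
      D d g b : ℤ
      D = badDivisor m n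
      d = m - n
      g = G m n
      b = B m n

    g∣D : g ∣ℤ D
    g∣D = divides (n * m * b) refl

    b∣D : b ∣ℤ D
    b∣D = ∣m⇒∣m*n g (divides (n * m) refl)

    n∣D : n ∣ℤ D
    n∣D = ∣m⇒∣m*n g (∣m⇒∣m*n b (∣m⇒∣m*n m (divides (+ 1) (sym (ℤ.*-identityˡ n)))))

    m∣D : m ∣ℤ D
    m∣D = ∣m⇒∣m*n g (∣m⇒∣m*n b (divides n refl))

    d∣D : d ∣ℤ D
    d∣D = ∣-trans (m-n∣B m n (divides (+ 1) (sym (ℤ.*-identityˡ d)))) b∣D

    module _ {ℓ : ℕ} (ℓ-prime : Prime ℓ) where
      private
        m⊥n′ : + ℓ ∣ℤ m → ¬ + ℓ ∣ℤ n
        m⊥n′ = coprime-∤ ℓ-prime m n m⊥n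

      ∤m∧d : + ℓ ∣ℤ m → ¬ + ℓ ∣ℤ d
      ∤m∧d ℓ∣m ℓ∣d = m⊥n′ ℓ∣m (∣-lin₂ (+ 1) (- + 1) ℓ∣m ℓ∣d (identity m n))
        where
        identity : ∀ m n → n ≡ + 1 * m + - + 1 * (m - n)
        identity = solve-∀

      ∤n∧d : + ℓ ∣ℤ n → ¬ + ℓ ∣ℤ d
      ∤n∧d ℓ∣n ℓ∣d = m⊥n′ (∣-lin₂ (+ 1) (+ 1) ℓ∣n ℓ∣d (identity m n)) ℓ∣n
        where
        identity : ∀ m n → m ≡ + 1 * n + + 1 * (m - n)
        identity = solve-∀

      ∤g∧m : + ℓ ∣ℤ g → ¬ + ℓ ∣ℤ m
      ∤g∧m = p∤g∧m ℓ-prime m n m⊥n′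

      ∤g∧n : + ℓ ∣ℤ g → ¬ + ℓ ∣ℤ n
      ∤g∧n = p∤n ℓ-prime m n m⊥n′

      ∤g∧d : + ℓ ∣ℤ g → ¬ + ℓ ∣ℤ d
      ∤g∧d ℓ∣g ℓ∣d = p∤g∧b ℓ-prime m n m⊥n′ ℓ∣g (m-n∣B m n ℓ∣d)

    2∣m∨2∣n∨2∣d : + 2 ∣ℤ m ⊎ + 2 ∣ℤ n ⊎ + 2 ∣ℤ d
    2∣m∨2∣n∨2∣d with + 2 ∣? m | + 2 ∣? n
    ... | yes 2∣m | _       = inj₁ 2∣m
    ... | no _    | yes 2∣n = inj₂ (inj₁ 2∣n)
    ... | no 2∤m  | no 2∤n  = inj₂ (inj₂ (odd-difference m n 2∤m 2∤n))

    -- 2 divides one of m, n and m - n, and g is coprime to all three.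
    2∤g : ¬ + 2 ∣ℤ g
    2∤g 2∣g = [ ∤g∧m prime[2] 2∣g , [ ∤g∧n prime[2] 2∣g , ∤g∧d prime[2] 2∣g ]′ ]′ 2∣m∨2∣n∨2∣d

    2∣D : + 2 ∣ℤ D
    2∣D = [ (λ 2∣m → ∣-trans 2∣m m∣D)
          , [ (λ 2∣n → ∣-trans 2∣n n∣D) , (λ 2∣d → ∣-trans 2∣d d∣D) ]′ ]′ 2∣m∨2∣n∨2∣d

    smallCurve : ∀ r → (∀ {ℓ} → Prime ℓ → + ℓ ∣ℤ D → ℓ ≡ 2 ⊎ ℓ ≡ r) →
      NonCuspidal m n → SmallCurve m n
    smallCurve r only nc with 2∣m∨2∣n∨2∣d
    ... | inj₁ 2∣m =
      [ (λ (un , ud) → n∧m-n nc un ud)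
      , [ (λ (un , ug) → n∧G nc un ug) , (λ (ud , ug) → m-n∧G nc ud ug) ]′ ]′
      (two-units D r only n∣D d∣D g∣D (coprime-∤ prime[2] m n m⊥n 2∣m) (∤m∧d prime[2] 2∣m) 2∤g
        ∤n∧d ∤g∧n ∤g∧d)
    ... | inj₂ (inj₁ 2∣n) =
      [ (λ (um , ud) → m∧m-n nc um ud)
      , [ (λ (um , ug) → m∧G nc um ug) , (λ (ud , ug) → m-n∧G nc ud ug) ]′ ]′
      (two-units D r only m∣D d∣D g∣D (λ 2∣m → coprime-∤ prime[2] m n m⊥n 2∣m 2∣n)
        (∤n∧d prime[2] 2∣n) 2∤g ∤m∧d ∤g∧m ∤g∧d)
    ... | inj₂ (inj₂ 2∣d) =
      [ (λ (um , un) → n∧m nc un um)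
      , [ (λ (um , ug) → m∧G nc um ug) , (λ (un , ug) → n∧G nc un ug) ]′ ]′
      (two-units D r only m∣D n∣D g∣D (λ 2∣m → ∤m∧d prime[2] 2∣m 2∣d)
        (λ 2∣n → ∤n∧d prime[2] 2∣n 2∣d) 2∤g (λ {ℓ} ℓ-prime → coprime-∤ ℓ-prime m n m⊥n)
        ∤g∧m ∤g∧n)

  -- The four remaining curves have three primes of bad reduction

  three-of-two : ∀ {p q x y z : ℕ} → x ≢ y → x ≢ z → y ≢ z →
    x ≡ p ⊎ x ≡ q → y ≡ p ⊎ y ≡ q → ¬ (z ≡ p ⊎ z ≡ q)
  three-of-two x≢y x≢z y≢z (inj₁ refl) (inj₁ refl) _           = x≢y refl
  three-of-two x≢y x≢z y≢z (inj₁ refl) (inj₂ refl) (inj₁ refl) = x≢z refl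
  three-of-two x≢y x≢z y≢z (inj₁ refl) (inj₂ refl) (inj₂ refl) = y≢z refl
  three-of-two x≢y x≢z y≢z (inj₂ refl) (inj₁ refl) (inj₁ refl) = y≢z refl
  three-of-two x≢y x≢z y≢z (inj₂ refl) (inj₁ refl) (inj₂ refl) = x≢z refl
  three-of-two x≢y x≢z y≢z (inj₂ refl) (inj₂ refl) _           = x≢y refl

  ThreeBadPrimes : EllipticCurve → Set
  ThreeBadPrimes E = ∃[ x ] ∃[ y ] ∃[ z ] Prime x × Prime y × Prime z × x ≢ y × x ≢ z × y ≢ z ×
    ¬ GoodModel E x × ¬ GoodModel E y × ¬ GoodModel E z

  opaque
    unfolding G B

    -- For (2 , 1) and (1 , 3), `badDivisor` is ± 6 and yields only 2 and 3. The third prime comes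
    -- from the further factor 4m² - 2mn - n² of Δ, which is ± 11 there, so 11 is tested directly on
    -- Δ and c₄.
    smallCurve⇒threeBadPrimes : ∀ E {m n} → SmallCurve m n → IntegralModel E (curve m n) →
      (∀ {ℓ} → Prime ℓ → + ℓ ∣ℤ badDivisor m n → ¬ GoodModel E ℓ) → ThreeBadPrimes E
    smallCurve⇒threeBadPrimes E [2,1] model bad =
      2 , 3 , 11 , prime[2] , from-yes (prime? 3) , from-yes (prime? 11) ,
      (λ ()) , (λ ()) , (λ ()) ,
      bad prime[2] (from-yes (+ 2 ∣? badDivisor (+ 2) (+ 1))) ,
      bad (from-yes (prime? 3)) (from-yes (+ 3 ∣? badDivisor (+ 2) (+ 1))) ,
      λ good-E → from-no (+ 121 ∣? c₄ℤ (curve (+ 2) (+ 1)))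
        (goodModel⇒p²∣c₄ (from-yes (prime? 11)) E good-E (curve (+ 2) (+ 1)) model
          (from-yes (+ 11 ∣? Δℤ (curve (+ 2) (+ 1)))))
    smallCurve⇒threeBadPrimes E [1,3] model bad =
      2 , 3 , 11 , prime[2] , from-yes (prime? 3) , from-yes (prime? 11) ,
      (λ ()) , (λ ()) , (λ ()) ,
      bad prime[2] (from-yes (+ 2 ∣? badDivisor (+ 1) (+ 3))) ,
      bad (from-yes (prime? 3)) (from-yes (+ 3 ∣? badDivisor (+ 1) (+ 3))) ,
      λ good-E → from-no (+ 121 ∣? c₄ℤ (curve (+ 1) (+ 3)))
        (goodModel⇒p²∣c₄ (from-yes (prime? 11)) E good-E (curve (+ 1) (+ 3)) model
          (from-yes (+ 11 ∣? Δℤ (curve (+ 1) (+ 3)))))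
    smallCurve⇒threeBadPrimes E [3,1] model bad =
      2 , 3 , 5 , prime[2] , from-yes (prime? 3) , from-yes (prime? 5) ,
      (λ ()) , (λ ()) , (λ ()) ,
      bad prime[2] (from-yes (+ 2 ∣? badDivisor (+ 3) (+ 1))) ,
      bad (from-yes (prime? 3)) (from-yes (+ 3 ∣? badDivisor (+ 3) (+ 1))) ,
      bad (from-yes (prime? 5)) (from-yes (+ 5 ∣? badDivisor (+ 3) (+ 1)))
    smallCurve⇒threeBadPrimes E [-1,1] model bad =
      2 , 3 , 5 , prime[2] , from-yes (prime? 3) , from-yes (prime? 5) ,
      (λ ()) , (λ ()) , (λ ()) ,
      bad prime[2] (from-yes (+ 2 ∣? badDivisor (- + 1) (+ 1))) ,
      bad (from-yes (prime? 3)) (from-yes (+ 3 ∣? badDivisor (- + 1) (+ 1))) ,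
      bad (from-yes (prime? 5)) (from-yes (+ 5 ∣? badDivisor (- + 1) (+ 1)))

  order10Curve-bad-primes : ∀ E → Order10Curve E → ∀ {p q} →
    ¬ (∀ {ℓ} → Prime ℓ → ¬ GoodModel E ℓ → ℓ ≡ p ⊎ ℓ ≡ q)
  order10Curve-bad-primes E C {p} {q} p∨q =
    let (x , y , z , x-prime , y-prime , z-prime , x≢y , x≢z , y≢z , bad-x , bad-y , bad-z) =
          smallCurve⇒threeBadPrimes E {m} {n} small model bad
    in three-of-two x≢y x≢z y≢z (p∨q x-prime bad-x) (p∨q y-prime bad-y) (p∨q z-prime bad-z)
    where
    open Order10Curve C
    bad : ∀ {ℓ} → Prime ℓ → + ℓ ∣ℤ badDivisor m n → ¬ GoodModel E ℓ
    bad = p∣badDivisor⇒¬goodModel E m n m⊥n model model-even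
    -- 2 always divides `badDivisor`, hence is one of `p` and `q`; the other one serves as `r`.
    otherPrime : 2 ≡ p ⊎ 2 ≡ q → ∃[ r ] (∀ {ℓ} → ℓ ≡ p ⊎ ℓ ≡ q → ℓ ≡ 2 ⊎ ℓ ≡ r)
    otherPrime (inj₁ refl) = q , λ ℓ → ℓ
    otherPrime (inj₂ refl) = p , swap
    r : ∃[ r ] (∀ {ℓ} → ℓ ≡ p ⊎ ℓ ≡ q → ℓ ≡ 2 ⊎ ℓ ≡ r)
    r = otherPrime (p∨q prime[2] (bad prime[2] (2∣D m n m⊥n)))
    small : SmallCurve m n
    small = smallCurve m n m⊥n (proj₁ r)
      (λ ℓ-prime ℓ∣D → proj₂ r (p∨q ℓ-prime (bad ℓ-prime ℓ∣D))) noncuspidal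

open BadPrimes

open import Data.Nat.Base using (_<_; _*_)

theorem3p9 : ¬ (∃[ E ]
    (∃[ P ] OnCurve E P × HasOrder E P 10) ×
    (∃[ p ] ∃[ q ] ∃[ α ] ∃[ β ]
    Prime p × Prime q × p ≢ q × 0 < α × 0 < β ×
    IsConductor E (p ^ α * q ^ β)))
theorem3p9 (E , (P , on-curve , order) ,
            (p , q , α , β , p-prime , q-prime , _ , _ , _ , conductor)) =
  order10Curve-bad-primes E (order10⇒order10Curve E P on-curve order)
    (¬goodModel⇒p∨q E p-prime q-prime α β conductor)
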